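{- For every finite simple undirected graph $G$ there exists $F \subseteq V(G)$ such that $G[F]$ is a forest and $\mathrm{mad}(G - F) \le \mathrm{mad}(G) - 2$. Moreover, such $F$ can be computed in polynomial time.
   Context: $\mathrm{mad}(G) := \max_{H \subseteq G,\, V(H)\neq\emptyset} \frac{2|E(H)|}{|V(H)|}$ (maximum average degree over nonempty subgraphs); by convention the graph with empty vertex set has $\mathrm{mad} = -\infty$. $G[F]$ is the induced subgraph on $F$ and $G - F = G[V(G)\setminus F]$. -}

module Defs where

open import Data.Bool.Base using (Bool; true; false; _∧_; T)
open import Data.Bool.Properties using (T?; ∧-comm; T-∧; T-≡)
open import Data.Fin.Base as Fin using (Fin; zero)
open import Data.Fin.Properties using (_<?_)
open import Data.Fin.Subset using (Subset; _∈_; _⊆_; _∩_; _─_; _-_; ∣_∣; Nonempty)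
open import Data.Fin.Subset.Properties
  using (x∈p∩q⁺; x∈p∩q⁻; p∩q⊆q; ⊆-antisym; nonempty?; Empty-unique; ∣⊥∣≡0;
         x∈p⇒∣p-x∣<∣p∣)
open import Data.Integer.Base using (+_)
open import Data.List.Base as List
  using (List; []; _∷_; _++_; length; map; filter; allFin; cartesianProduct; cartesianProductWith)
open import Data.List.Extrema using (max; xs≤max; argmax-sel)
open import Data.List.Membership.Propositional using () renaming (_∈_ to _∈ᴸ_)
open import Data.List.Membership.Propositional.Properties
  using (∈-map⁺; ∈-map⁻; ∈-cartesianProductWith⁺; ∈-cartesianProductWith⁻)
open import Data.List.Properties using (filter-≐)
open import Data.List.Relation.Unary.All as All using ()
open import Data.List.Relation.Unary.Any using (here; there)
open import Data.List.Relation.Unary.Linked using (Linked)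
open import Data.List.Relation.Unary.Unique.Propositional using (Unique)
open import Data.Nat.Base as ℕ using (ℕ; zero; suc; _+_; _*_; _^_)
open import Data.Product.Base using (Σ; ∃; ∃-syntax; _×_; _,_; proj₁; proj₂)
open import Data.Rational.Base as ℚ using (ℚ; _/_)
import Data.Nat.Properties as ℕ
import Data.Rational.Properties as ℚ
open import Data.Sum.Base using (inj₁; inj₂)
open import Data.Vec.Base as Vec using (Vec; []; _∷_; lookup; tabulate; replicate; _[_]≔_)
open import Data.Vec.Properties using (lookup∘tabulate; []=⇒lookup; lookup⇒[]=)
open import Function.Bundles using (module Equivalence)
open import Level using (0ℓ)
open import Relation.Binary.Bundles using (TotalOrder)
open import Relation.Binary.PropositionalEquality
  using (_≡_; _≢_; refl; sym; trans; cong; cong₂; subst)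
import Relation.Binary.Construct.Add.Infimum.NonStrict as AddInfimum
open import Relation.Nullary using (¬_; yes; no; contradiction)
open import Relation.Nullary.Construct.Add.Infimum using (_₋) renaming (⊥₋ to -∞; [_] to fin)
open import Relation.Nullary.Decidable using (_×-dec_)
open import Relation.Unary using (Decidable)

private
  variable
    n k : ℕ

-- The vertex set is a subset of Fin n rather than all of Fin n, so that
-- subgraphs are graphs over the same n.
record Graph (n : ℕ) : Set where
  field
    vertices    : Subset n
    adj         : Fin n → Fin n → Bool
    symmetric   : ∀ u v → adj u v ≡ adj v u
    irreflexive : ∀ v → ¬ T (adj v v)
    endpoint    : ∀ u v → T (adj u v) → u ∈ vertices

  Adj : Fin n → Fin n → Set
  Adj u v = T (adj u v)

open Graph public

IsEdge : Graph n → Fin n × Fin n → Set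
IsEdge G (u , v) = u Fin.< v × Adj G u v

isEdge? : (G : Graph n) → Decidable (IsEdge G)
isEdge? G (u , v) = (u <? v) ×-dec T? (adj G u v)

edges : Graph n → List (Fin n × Fin n)
edges {n} G = filter (isEdge? G) (cartesianProduct (allFin n) (allFin n))

infix 4 _⊆ᴳ_

_⊆ᴳ_ : Graph n → Graph n → Set
H ⊆ᴳ G = vertices H ⊆ vertices G × (∀ u v → Adj H u v → Adj G u v)

private
  lookup-T : ∀ (S : Subset n) v → T (lookup S v) → v ∈ S
  lookup-T S v t = lookup⇒[]= v S (Equivalence.to T-≡ t)

  T-lookup : ∀ (S : Subset n) v → v ∈ S → T (lookup S v)
  T-lookup S v v∈S = Equivalence.from T-≡ ([]=⇒lookup v∈S)

  ∧⁻ : ∀ {a b} → T (a ∧ b) → T a × T b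
  ∧⁻ = Equivalence.to T-∧

  ∧⁺ : ∀ {a b} → T a → T b → T (a ∧ b)
  ∧⁺ s t = Equivalence.from T-∧ (s , t)

infix 8 _[_]
infixl 7 _∖_

_[_] : Graph n → Subset n → Graph n
G [ S ] = record
  { vertices    = vertices G ∩ S
  ; adj         = λ u v → adj G u v ∧ (lookup S u ∧ lookup S v)
  ; symmetric   = λ u v → cong₂ _∧_ (symmetric G u v) (∧-comm (lookup S u) (lookup S v))
  ; irreflexive = λ v t → irreflexive G v (proj₁ (∧⁻ t))
  ; endpoint    = λ u v t → let (e , s) = ∧⁻ t in
      x∈p∩q⁺ (endpoint G u v e , lookup-T S u (proj₁ (∧⁻ s)))
  }

_∖_ : Graph n → Subset n → Graph n
G ∖ S = G [ vertices G ─ S ]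

-- A cycle u, v, w, vs, u: at least three vertices, pairwise distinct.
IsCycle : Graph n → (u v w : Fin n) → List (Fin n) → Set
IsCycle G u v w vs =
  Unique (u ∷ v ∷ w ∷ vs) × Linked (Adj G) (u ∷ v ∷ w ∷ vs ++ u ∷ [])

IsForest : Graph n → Set
IsForest G = ∀ u v w vs → ¬ IsCycle G u v w vs

ℚ-∞ : Set
ℚ-∞ = ℚ ₋

open AddInfimum ℚ._≤_ public using (_≤₋_)

ℚ-∞-totalOrder : TotalOrder 0ℓ 0ℓ 0ℓ
ℚ-∞-totalOrder = record { isTotalOrder = AddInfimum.≤₋-isTotalOrder-≡ ℚ._≤_ ℚ.≤-isTotalOrder }

infixl 6 _-₋_

_-₋_ : ℚ-∞ → ℚ → ℚ-∞
-∞    -₋ q = -∞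
fin p -₋ q = fin (p ℚ.- q)

ratio : ℕ → ℕ → ℚ-∞
ratio m zero    = -∞
ratio m (suc k) = fin (+ m / suc k)

averageDegree : Graph n → ℚ-∞
averageDegree G = ratio (2 * length (edges G)) ∣ vertices G ∣

keepEdges : Vec (Subset n) n → Graph n → Graph n
keepEdges M G = record
  { vertices    = vertices G
  ; adj         = λ u v → adj G u v ∧ (m u v ∧ m v u)
  ; symmetric   = λ u v → cong₂ _∧_ (symmetric G u v) (∧-comm (m u v) (m v u))
  ; irreflexive = λ v t → irreflexive G v (proj₁ (∧⁻ t))
  ; endpoint    = λ u v t → endpoint G u v (proj₁ (∧⁻ t))
  }
  where
  m : _ → _ → Bool
  m u v = lookup (lookup M u) v

allVecs : ∀ {A : Set} → List A → ∀ n → List (Vec A n)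
allVecs xs zero    = [] ∷ []
allVecs xs (suc n) = cartesianProductWith _∷_ xs (allVecs xs n)

allSubsets : ∀ n → List (Subset n)
allSubsets = allVecs (true ∷ false ∷ [])

subgraphs : Graph n → List (Graph n)
subgraphs {n} G =
  cartesianProductWith (λ S M → keepEdges M (G [ S ]))
    (allSubsets n) (allVecs (allSubsets n) n)

-- Subgraphs without vertices contribute -∞, hence nothing, to the
-- maximum; see averageDegree≤mad and mad-attained.
mad : Graph n → ℚ-∞
mad G = max ℚ-∞-totalOrder -∞ (map averageDegree (subgraphs G))

private
  ∈-allVecs : ∀ {A : Set} {xs : List A} → (∀ x → x ∈ᴸ xs) → ∀ {n} (v : Vec A n) → v ∈ᴸ allVecs xs n
  ∈-allVecs all []      = here refl
  ∈-allVecs all (x ∷ v) = ∈-cartesianProductWith⁺ _∷_ (all x) (∈-allVecs all v)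

  ∈-allSubsets : (S : Subset n) → S ∈ᴸ allSubsets n
  ∈-allSubsets = ∈-allVecs λ { true → here refl ; false → there (here refl) }

  averageDegree-cong : (G H : Graph n) → vertices G ≡ vertices H →
    (∀ u v → Adj G u v → Adj H u v) → (∀ u v → Adj H u v → Adj G u v) →
    averageDegree G ≡ averageDegree H
  averageDegree-cong {n} G H V≡ to from = cong₂ (λ es S → ratio (2 * length es) ∣ S ∣)
    (filter-≐ (isEdge? G) (isEdge? H)
      ((λ (lt , e) → lt , to _ _ e) , (λ (lt , e) → lt , from _ _ e))
      (cartesianProduct (allFin n) (allFin n)))
    V≡

  averageDegree∈ : (G H : Graph n) → H ⊆ᴳ G → averageDegree H ∈ᴸ map averageDegree (subgraphs G)
  averageDegree∈ {n} G H (V⊆ , E⊆) =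
    subst (_∈ᴸ map averageDegree (subgraphs G)) (averageDegree-cong K H V≡ to from)
      (∈-map⁺ averageDegree
        (∈-cartesianProductWith⁺ _ (∈-allSubsets S) (∈-allVecs ∈-allSubsets M)))
    where
    S : Subset n
    S = vertices H

    M : Vec (Subset n) n
    M = tabulate λ u → tabulate (adj H u)

    K : Graph n
    K = keepEdges M (G [ S ])

    M≡ : ∀ u v → lookup (lookup M u) v ≡ adj H u v
    M≡ u v = trans (cong (λ r → lookup r v) (lookup∘tabulate _ u)) (lookup∘tabulate (adj H u) v)

    V≡ : vertices K ≡ S
    V≡ = ⊆-antisym (p∩q⊆q (vertices G) S) (λ x∈S → x∈p∩q⁺ (V⊆ x∈S , x∈S))

    to : ∀ u v → Adj K u v → Adj H u v
    to u v t = subst T (M≡ u v) (proj₁ (∧⁻ (proj₂ (∧⁻ {adj (G [ S ]) u v} t))))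

    from : ∀ u v → Adj H u v → Adj K u v
    from u v t = ∧⁺
      (∧⁺ (E⊆ u v t) (∧⁺ (T-lookup S u (endpoint H u v t)) (T-lookup S v (endpoint H v u t′))))
      (∧⁺ (subst T (sym (M≡ u v)) t) (subst T (sym (M≡ v u)) t′))
      where
      t′ : Adj H v u
      t′ = subst T (symmetric H u v) t

  subgraph⊆ : (G H : Graph n) → H ∈ᴸ subgraphs G → H ⊆ᴳ G
  subgraph⊆ {n} G H H∈ with ∈-cartesianProductWith⁻ _ (allSubsets n) _ H∈
  ... | S , M , _ , _ , refl =
    (λ x∈ → proj₁ (x∈p∩q⁻ (vertices G) S x∈)) , (λ u v t → proj₁ (∧⁻ (proj₁ (∧⁻ t))))

  ratio≢-∞ : ∀ m k {q} → ratio m k ≡ fin q → k ≢ 0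
  ratio≢-∞ m zero    () _
  ratio≢-∞ m (suc k) _  ()

  ratio≡-∞ : ∀ m k → ratio m k ≡ -∞ → k ≡ 0
  ratio≡-∞ m zero _ = refl

  ∣S∣≢0 : ∀ {n} (S : Subset n) → ∣ S ∣ ≢ 0 → Nonempty S
  ∣S∣≢0 {n} S ≢0 with nonempty? S
  ... | yes p = p
  ... | no ¬p = contradiction (trans (cong ∣_∣ (Empty-unique ¬p)) (∣⊥∣≡0 n)) ≢0

averageDegree≤mad : (G H : Graph n) → H ⊆ᴳ G → averageDegree H ≤₋ mad G
averageDegree≤mad G H H⊆G =
  All.lookup (xs≤max ℚ-∞-totalOrder -∞ (map averageDegree (subgraphs G))) (averageDegree∈ G H H⊆G)

mad-attained : (G : Graph n) → Nonempty (vertices G) →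
  ∃[ H ] H ⊆ᴳ G × Nonempty (vertices H) × averageDegree H ≡ mad G
mad-attained G (x , x∈V) = go (mad G) refl
  where
  G≤ : averageDegree G ≤₋ mad G
  G≤ = averageDegree≤mad G G ((λ z → z) , (λ _ _ z → z))

  ∣V∣≢0 : ∣ vertices G ∣ ≢ 0
  ∣V∣≢0 eq = ℕ.n≮0 (subst (∣ vertices G - x ∣ ℕ.<_) eq (x∈p⇒∣p-x∣<∣p∣ x∈V))

  go : ∀ q → mad G ≡ q → ∃[ H ] H ⊆ᴳ G × Nonempty (vertices H) × averageDegree H ≡ mad G
  go -∞ eq with averageDegree G in dG | subst (averageDegree G ≤₋_) eq G≤
  ... | -∞ | _ = contradiction (ratio≡-∞ (2 * length (edges G)) ∣ vertices G ∣ dG) ∣V∣≢0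
  go (fin q) eq
    with argmax-sel ℚ-∞-totalOrder (λ r → r) -∞ (map averageDegree (subgraphs G))
  ... | inj₁ mad≡-∞ with () ← trans (sym eq) mad≡-∞
  ... | inj₂ mad∈ with ∈-map⁻ averageDegree mad∈
  ... | H , H∈ , mad≡ =
    H , subgraph⊆ G H H∈ ,
    ∣S∣≢0 (vertices H)
      (ratio≢-∞ (2 * length (edges H)) ∣ vertices H ∣ (trans (sym mad≡) eq)) ,
    sym mad≡

-- The WHILE language of Jones, "Computability and Complexity".  With
-- trees held as pointers to shared immutable cells, one unit of time
-- below is a constant number of pointer operations.  Hence polynomial
-- time agrees with polynomial time on Turing machines, provided that
-- results have polynomially many nodes; the encoded vertex sets which
-- are computed here are smaller than the input.

infixr 5 _∙_

data Tree : Set where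
  nil : Tree
  _∙_ : Tree → Tree → Tree

size : Tree → ℕ
size nil     = 1
size (s ∙ t) = suc (size s + size t)

left : Tree → Tree
left nil     = nil
left (s ∙ t) = s

right : Tree → Tree
right nil     = nil
right (s ∙ t) = t

data Expr (k : ℕ) : Set where
  var   : Fin k → Expr k
  nil   : Expr k
  cons  : Expr k → Expr k → Expr k
  hd tl : Expr k → Expr k

infixr 4 _⨾_
infix  5 _≔_

data Command (k : ℕ) : Set where
  _≔_   : Fin k → Expr k → Command k
  _⨾_   : Command k → Command k → Command k
  while : Expr k → Command k → Command k

Store : ℕ → Set
Store = Vec Tree

eval : Expr k → Store k → Tree
eval (var x)    σ = lookup σ x
eval nil        σ = nil
eval (cons d e) σ = eval d σ ∙ eval e σ
eval (hd e)     σ = left (eval e σ)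
eval (tl e)     σ = right (eval e σ)

cost : Expr k → ℕ
cost (var x)    = 1
cost nil        = 1
cost (cons d e) = suc (cost d + cost e)
cost (hd e)     = suc (cost e)
cost (tl e)     = suc (cost e)

-- ⟨ c , σ ⟩⇓⟨ t , τ ⟩: started in σ, c halts in τ after time t.
data ⟨_,_⟩⇓⟨_,_⟩ {k : ℕ} : Command k → Store k → ℕ → Store k → Set where
  assign : ∀ {x e σ} → ⟨ x ≔ e , σ ⟩⇓⟨ suc (cost e) , σ [ x ]≔ eval e σ ⟩
  seq    : ∀ {c d ρ σ τ s t} →
           ⟨ c , ρ ⟩⇓⟨ s , σ ⟩ → ⟨ d , σ ⟩⇓⟨ t , τ ⟩ →
           ⟨ c ⨾ d , ρ ⟩⇓⟨ suc (s + t) , τ ⟩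
  stop   : ∀ {e c σ} → eval e σ ≡ nil →
           ⟨ while e c , σ ⟩⇓⟨ suc (cost e) , σ ⟩
  loop   : ∀ {e c ρ σ τ s t} → eval e ρ ≢ nil →
           ⟨ c , ρ ⟩⇓⟨ s , σ ⟩ → ⟨ while e c , σ ⟩⇓⟨ t , τ ⟩ →
           ⟨ while e c , ρ ⟩⇓⟨ suc (cost e + s + t) , τ ⟩

encodeBool : Bool → Tree
encodeBool false = nil
encodeBool true  = nil ∙ nil

encodeVec : {A : Set} → (A → Tree) → Vec A n → Tree
encodeVec f []      = nil
encodeVec f (x ∷ v) = f x ∙ encodeVec f v

encodeSubset : Subset n → Tree
encodeSubset = encodeVec encodeBool

encodeGraph : Graph n → Tree
encodeGraph G =
  encodeSubset (vertices G) ∙ encodeVec encodeSubset (tabulate λ u → tabulate (adj G u))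

-- Variable zero holds the input and the output; the other variables
-- initially hold nil.
ComputableInPolynomialTime : (∀ {n} → Graph n → Subset n → Set) → Set
ComputableInPolynomialTime R =
  ∃[ k ] Σ (Command (suc k)) λ program → ∃[ a ] ∃[ d ]
    ∀ {n} (G : Graph n) → ∃[ S ] R G S ×
      ∃[ t ] Σ (Store (suc k)) λ τ →
        ⟨ program , encodeGraph G ∷ replicate k nil ⟩⇓⟨ t , τ ⟩ ×
        lookup τ zero ≡ encodeSubset S ×
        t ℕ.≤ a * size (encodeGraph G) ^ d + a

{-# OPTIONS --safe #-}
module Submission where

-- Let each edge distribute a weight of 2K among its ends according to
-- heights p of the vertices: ends at equal heights get K each, and the
-- share of the higher end falls linearly to 0 as the difference grows to K.
-- The load of v is the weight it receives.  Raise the vertices from p = 0,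
-- one unit at a time, while p v < K * load v; in the end p ≈ K * load.
-- Among the sets of vertices at height at least p v - j * K, for j ≤ n, two
-- consecutive ones agree.  Such a set receives no weight from the edges
-- which leave it, so it spans a subgraph of average degree at least about
-- load v / K.  Hence all loads are at most K * mad G, up to a small error.
--
-- Now go through the vertices by descending height, and put a vertex into F
-- unless two of its neighbours are there already.  Then G [ F ] is a
-- forest, as the last vertex of a cycle would have two earlier neighbours.
-- A vertex outside F receives at least K from each of two higher neighbours
-- in F, so at most K * (mad G - 2) from G ∖ F, up to the same error, and
-- this bounds mad (G ∖ F).  For K > 3n³ the error is below 1/n², but
-- distinct average degrees differ by more, so it vanishes.

import Data.Integer.Properties as ℤ
import Data.Integer.Tactic.RingSolver as ℤSolver
import Data.Fin.Properties as Fin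
import Data.List.Relation.Unary.All as All
import Data.List.Relation.Unary.All.Properties as All
import Data.Nat.Properties as ℕ
import Data.Rational.Properties as ℚ
import Data.Rational.Unnormalised.Properties as ℚᵘ
open import Algebra.Properties.Semiring.Sum ℕ.+-*-semiring
  using (sum; sum-cong-≗; ∑-distrib-+; ∑-comm; *-distribˡ-sum; *-distribʳ-sum)
open import Data.Bool.Base using (Bool; true; false; if_then_else_; _∧_; T)
open import Data.Bool.Properties using (T?; T-∧; T-≡)
open import Data.Empty using (⊥-elim)
open import Data.Fin.Base as Fin using (Fin; zero; suc; toℕ)
open import Data.Fin.Patterns using (0F; 1F; 2F; 3F; 4F; 5F; 6F; 7F; 8F)
open import Data.Fin.Subset
  using (Subset; inside; outside; _∈_; _∉_; _⊆_; _⊂_; _─_; _-_; ∣_∣; Nonempty)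
open import Data.Fin.Subset.Properties
  using (p⊂q⇒∣p∣<∣q∣; ∣p∣≤n; _⊂?_; _∈?_; nonempty?; Empty-unique; ∣⊥∣≡0; x∈p∩q⁺; x∈p∩q⁻; x∈p⇒∣p-x∣<∣p∣)
open import Data.Integer.Base as ℤ using (ℤ; +_)
open import Data.List.Base as List using (List; []; _∷_; _++_; length; map; filter; cartesianProduct)
open import Data.List.Extrema using (max≤v⁺)
open import Data.List.Extrema ℕ.≤-totalOrder
  using (argmin; argmin-sel; f[argmin]≤f[xs]; f[argmin]≤f[⊤])
open import Data.List.Membership.Propositional using () renaming (_∈_ to _∈ᴸ_)
open import Data.List.Membership.Propositional.Properties using (∈-++⁻; ∈-cartesianProductWith⁻)
open import Data.List.Properties using (filter-++; length-++)
open import Data.List.Relation.Unary.All using (All; []; _∷_)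
open import Data.List.Relation.Unary.AllPairs using (_∷_)
open import Data.List.Relation.Unary.Any using (here; there)
open import Data.List.Relation.Unary.Linked using (Linked; [-]; _∷_)
open import Data.List.Relation.Unary.Unique.Propositional using (Unique)
open import Data.Nat.Base
  using (ℕ; zero; suc; pred; _+_; _*_; _∸_; _^_; _≤_; _<_; _≤ᵇ_; z≤n; s≤s; NonZero; ≢-nonZero; >-nonZero)
open import Data.Nat.Tactic.RingSolver using (solve-∀)
open import Data.Product.Base using (∃-syntax; Σ; _×_; _,_; proj₁; proj₂)
open import Data.Rational.Base as ℚ using (_/_; toℚᵘ)
open import Data.Rational.Unnormalised.Base as ℚᵘ using (mkℚᵘ; *≤*)
open import Data.Sum.Base using (_⊎_; inj₁; inj₂; [_,_]′)
open import Data.Vec.Base as Vec using (Vec; []; _∷_; here; there; lookup; tabulate)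
open import Data.Vec.Properties using (lookup∘tabulate; []=⇒lookup; lookup⇒[]=)
open import Defs
open import Function.Base using (_∘_)
open import Function.Bundles using (module Equivalence)
open import Relation.Binary.Construct.Add.Infimum.NonStrict ℚ._≤_
  using (⊥₋≤_) renaming ([_] to [_]₋)
open import Relation.Binary.Definitions using (tri<; tri≈; tri>)
open import Relation.Binary.PropositionalEquality
  using (_≡_; _≢_; _≗_; refl; sym; trans; cong; cong₂; subst; subst₂; ≢-sym)
open import Relation.Nullary using (¬_; Dec; does; yes; no; contradiction)
open import Relation.Nullary.Decidable using (dec-true; dec-false)
open import Relation.Unary using (Decidable)

private
  variable
    n : ℕ

open ℕ.≤-Reasoning hiding (stop)

-- A language of right folds over trees, and its compiler

infixr 4 _⨟_
infixr 5 _&_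

-- The only iteration is a fold over a list at hand, so that every program halts, and its time is
-- polynomial in a bound on the lengths of the folded lists.
data Fun : Set where
  expr : Expr 1 → Fun
  _⨟_  : Fun → Fun → Fun
  _&_  : Fun → Fun → Fun
  fold : Fun → Fun

spine : Tree → ℕ
spine nil     = 0
spine (s ∙ t) = suc (spine t)

-- Run N f x y: f maps x to y, and every list that is folded over on the
-- way has at most N elements.  The input of fold f is (l ∙ m) ∙ (a ∙ e):
-- a right fold over the list l zipped with m (padded by nil), from the
-- initial value a, whose body f also sees the environment e.
data Run (N : ℕ) : Fun → Tree → Tree → Set
data FoldRun (N : ℕ) (f : Fun) (e : Tree) : (l m a b : Tree) → Set

data Run N where
  expr : ∀ {d x} → Run N (expr d) x (eval d (x ∷ []))
  _⨟_  : ∀ {f g x y z} → Run N f x y → Run N g y z → Run N (f ⨟ g) x z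
  _&_  : ∀ {f g x y z} → Run N f x y → Run N g x z → Run N (f & g) x (y ∙ z)
  fold : ∀ {f l m a e b} → spine l ≤ N → FoldRun N f e l m a b →
         Run N (fold f) ((l ∙ m) ∙ (a ∙ e)) b

data FoldRun N f e where
  []  : ∀ {m a} → FoldRun N f e nil m a a
  _∷_ : ∀ {h l m a b c} →
        Run N f ((h ∙ left m) ∙ (b ∙ e)) c → FoldRun N f e l (right m) a b →
        FoldRun N f e (h ∙ l) m a c

val stk : Expr 2
val = var 0F
stk = var 1F

embed : Expr 1 → Expr 2
embed (var zero)  = val
embed nil         = nil
embed (cons d e)  = cons (embed d) (embed e)
embed (hd e)      = hd (embed e)
embed (tl e)      = tl (embed e)

eval-embed : ∀ e u v → eval (embed e) (u ∷ v ∷ []) ≡ eval e (u ∷ [])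
eval-embed (var zero)  u v = refl
eval-embed nil         u v = refl
eval-embed (cons d e)  u v = cong₂ _∙_ (eval-embed d u v) (eval-embed e u v)
eval-embed (hd e)      u v = cong left (eval-embed e u v)
eval-embed (tl e)      u v = cong right (eval-embed e u v)

unzipStep popStep : Command 2
unzipStep =
  1F ≔ cons (cons (cons (hd (hd (hd val))) (hd (tl (hd val)))) (hd stk)) (tl stk) ⨾
  0F ≔ cons (cons (tl (hd (hd val))) (tl (tl (hd val)))) (tl val)
popStep =
  0F ≔ cons (hd (hd (tl stk))) (cons val (hd stk)) ⨾
  1F ≔ cons (hd stk) (cons (tl (hd (tl stk))) (tl (tl stk)))

-- The first variable holds the value, the second one is a stack, which
-- every compiled function leaves as it was.  A fold first pushes its
-- zipped list in reverse, and then consumes it from the far end.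
compile : Fun → Command 2
compile (expr e) = 0F ≔ embed e
compile (f ⨟ g)  = compile f ⨾ compile g
compile (f & g)  =
  1F ≔ cons val stk ⨾
  compile f ⨾
  -- The stack is now the saved input on top of the old stack. Packing the result of `f` together
  -- with it allows a swap without a third variable: the result goes onto the stack, and the input
  -- comes back for `g`.
  0F ≔ cons val stk ⨾
  1F ≔ cons (hd val) (tl (tl val)) ⨾
  0F ≔ hd (tl val) ⨾
  compile g ⨾
  0F ≔ cons (hd stk) val ⨾
  1F ≔ tl stk
compile (fold f) =
  1F ≔ cons nil stk ⨾
  while (hd (hd val)) unzipStep ⨾
  1F ≔ cons (tl (tl val)) stk ⨾
  0F ≔ hd (tl val) ⨾
  while (hd (tl stk)) (popStep ⨾ compile f) ⨾
  1F ≔ tl (tl stk)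

-- The numerals are the times of the assignments and tests in compile.
budget : Fun → ℕ → ℕ
budget (expr e) N = suc (cost (embed e))
budget (f ⨟ g)  N = suc (budget f N + budget g N)
budget (f & g)  N = 6 + (budget f N + (19 + (budget g N + 9)))
budget (fold f) N = 6 + (4 + N * 40 + (13 + (N * (50 + budget f N) + 4 + 4)))

revZipOnto : Tree → Tree → Tree → Tree
revZipOnto nil     m r = r
revZipOnto (h ∙ l) m r = revZipOnto l (right m) ((h ∙ left m) ∙ r)

unzip-loop : ∀ l m w r σ → ∃[ t ] ∃[ m′ ]
  ⟨ while (hd (hd val)) unzipStep , ((l ∙ m) ∙ w) ∷ (r ∙ σ) ∷ [] ⟩⇓⟨ t
    , ((nil ∙ m′) ∙ w) ∷ (revZipOnto l m r ∙ σ) ∷ [] ⟩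
  × t ≤ 4 + spine l * 40
unzip-loop nil     m w r σ = _ , m , stop refl , ℕ.≤-refl
unzip-loop (h ∙ l) m w r σ with unzip-loop l (right m) w ((h ∙ left m) ∙ r) σ
... | t , m′ , run , t≤ = _ , m′ , loop (λ ()) (seq assign assign) run ,
  -- One round takes 34 units of time, which `budget` rounds up to 40.
  ℕ.+-mono-≤ (ℕ.m≤m+n 34 6) t≤

-- The stack `σ` is arbitrary, since the parts of a pairing or a fold run on top of saved data.
compile-correct : ∀ {N f u v} → Run N f u v → ∀ σ → ∃[ t ]
  ⟨ compile f , u ∷ σ ∷ [] ⟩⇓⟨ t , v ∷ σ ∷ [] ⟩ × t ≤ budget f N
-- The rest of the run is an argument: the head of the list lies deepest on the stack, so its round
-- comes last and is put in front of that rest before the induction goes on to the tail.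
fold-loop : ∀ {N f e l m a b} → FoldRun N f e l m a b → ∀ {r σ t τ} →
  ⟨ while (hd (tl stk)) (popStep ⨾ compile f) , b ∷ (e ∙ (r ∙ σ)) ∷ [] ⟩⇓⟨ t , τ ⟩ →
  ∃[ t′ ] ⟨ while (hd (tl stk)) (popStep ⨾ compile f) ,
            a ∷ (e ∙ (revZipOnto l m r ∙ σ)) ∷ [] ⟩⇓⟨ t′ , τ ⟩
  × t′ ≤ spine l * (50 + budget f N) + t

fold-loop []           run = _ , run , ℕ.≤-refl
fold-loop {N} {f} {l = h ∙ l} (body ∷ rest) {t = t} run with compile-correct body _
... | t₁ , run₁ , t₁≤ with fold-loop rest (loop (λ ()) (seq (seq assign assign) run₁) run)
... | t₂ , run₂ , t₂≤ = t₂ , run₂ , (begin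
  t₂                                          ≤⟨ t₂≤ ⟩
  spine l * c + (28 + t₁ + t)                 ≤⟨ ℕ.+-monoʳ-≤ (spine l * c) (ℕ.+-monoˡ-≤ t (ℕ.+-mono-≤ (ℕ.m≤m+n 28 22) t₁≤)) ⟩
  spine l * c + (c + t)                       ≡⟨ ℕ.+-assoc (spine l * c) c t ⟨
  spine l * c + c + t                         ≡⟨ cong (_+ t) (ℕ.+-comm (spine l * c) c) ⟩
  c + spine l * c + t                         ∎)
  where
  c : ℕ
  c = 50 + budget f N

compile-correct {f = expr e} {u} expr σ =
  _ , subst (λ w → ⟨ 0F ≔ embed e , u ∷ σ ∷ [] ⟩⇓⟨ _ , w ∷ σ ∷ [] ⟩) (eval-embed e u σ) assign , ℕ.≤-refl
compile-correct (r ⨟ r′) σ with compile-correct r σ | compile-correct r′ σ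
... | t , run , t≤ | t′ , run′ , t′≤ = _ , seq run run′ , s≤s (ℕ.+-mono-≤ t≤ t′≤)
compile-correct {u = u} (_&_ {y = y} r r′) σ
  with compile-correct r (u ∙ σ) | compile-correct r′ (y ∙ σ)
... | t , run , t≤ | t′ , run′ , t′≤ =
  _ , seq assign (seq run (seq assign (seq assign (seq assign (seq run′ (seq assign assign)))))) ,
  ℕ.+-monoʳ-≤ 6 (ℕ.+-mono-≤ t≤ (ℕ.+-monoʳ-≤ 19 (ℕ.+-monoˡ-≤ 9 t′≤)))
compile-correct {N} {fold f} (fold {l = l} {m} {a} {e} l≤ r) σ
  with unzip-loop l m (a ∙ e) nil σ
... | t , m′ , run , t≤ with fold-loop r {nil} {σ} (stop refl)
... | t′ , run′ , t′≤ =
  _ , seq assign (seq run (seq assign (seq assign (seq run′ assign)))) ,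
  ℕ.+-monoʳ-≤ 6 (ℕ.+-mono-≤ (ℕ.≤-trans t≤ (ℕ.+-monoʳ-≤ 4 (ℕ.*-monoˡ-≤ 40 l≤)))
    (ℕ.+-monoʳ-≤ 13 (ℕ.+-monoˡ-≤ 4
      (ℕ.≤-trans t′≤ (ℕ.+-monoˡ-≤ 4 (ℕ.*-monoˡ-≤ (50 + budget f N) l≤))))))

-- Polynomial bounds

PolyBounded : (ℕ → ℕ) → Set
PolyBounded f = ∃[ a ] ∃[ d ] ∀ n → f n ≤ a * suc n ^ d

const-poly : ∀ c → PolyBounded (λ _ → c)
const-poly c = c , 0 , λ _ → ℕ.≤-reflexive (sym (ℕ.*-identityʳ c))

id-poly : PolyBounded (λ n → n)
id-poly = 1 , 1 , λ n → ℕ.≤-trans (ℕ.n≤1+n n)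
  (ℕ.≤-reflexive (sym (trans (ℕ.*-identityˡ _) (ℕ.^-identityʳ (suc n)))))

+-poly : ∀ {f g} → PolyBounded f → PolyBounded g → PolyBounded (λ n → f n + g n)
+-poly {f} {g} (a , d , f≤) (b , e , g≤) = a + b , d + e , λ n → begin
  f n + g n                              ≤⟨ ℕ.+-mono-≤ (f≤ n) (g≤ n) ⟩
  -- Both powers are raised to a common exponent, which requires a positive base; hence `suc n` in
  -- `PolyBounded`.
  a * suc n ^ d + b * suc n ^ e          ≤⟨ ℕ.+-mono-≤ (ℕ.*-monoʳ-≤ a (ℕ.^-monoʳ-≤ (suc n) (ℕ.m≤m+n d e)))
                                                        (ℕ.*-monoʳ-≤ b (ℕ.^-monoʳ-≤ (suc n) (ℕ.m≤n+m e d))) ⟩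
  a * suc n ^ (d + e) + b * suc n ^ (d + e) ≡⟨ ℕ.*-distribʳ-+ (suc n ^ (d + e)) a b ⟨
  (a + b) * suc n ^ (d + e)              ∎

*-poly : ∀ {f g} → PolyBounded f → PolyBounded g → PolyBounded (λ n → f n * g n)
*-poly {f} {g} (a , d , f≤) (b , e , g≤) = a * b , d + e , λ n → begin
  f n * g n                        ≤⟨ ℕ.*-mono-≤ (f≤ n) (g≤ n) ⟩
  a * suc n ^ d * (b * suc n ^ e)  ≡⟨ ℕ.[m*n]*[o*p]≡[m*o]*[n*p] a (suc n ^ d) b (suc n ^ e) ⟩
  a * b * (suc n ^ d * suc n ^ e)  ≡⟨ cong (a * b *_) (ℕ.^-distribˡ-+-* (suc n) d e) ⟨
  a * b * suc n ^ (d + e)          ∎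

suc-poly : ∀ {f} → PolyBounded f → PolyBounded (λ n → suc (f n))
suc-poly = +-poly (const-poly 1)

^-poly : ∀ {f} → PolyBounded f → ∀ k → PolyBounded (λ n → f n ^ k)
^-poly p zero    = const-poly 1
^-poly p (suc k) = *-poly p (^-poly p k)

∘-poly : ∀ {f g} → PolyBounded f → PolyBounded g → PolyBounded (λ n → f (g n))
∘-poly {f} {g} (a , d , f≤) pg with *-poly (const-poly a) (^-poly (suc-poly pg) d)
... | b , e , ≤b = b , e , λ n → ℕ.≤-trans (f≤ (g n)) (≤b n)

budget-poly : ∀ f → PolyBounded (budget f)
budget-poly (expr e) = const-poly _
budget-poly (f ⨟ g)  = suc-poly (+-poly (budget-poly f) (budget-poly g))
budget-poly (f & g)  = +-poly (const-poly 6)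
  (+-poly (budget-poly f) (+-poly (const-poly 19) (+-poly (budget-poly g) (const-poly 9))))
budget-poly (fold f) = +-poly (const-poly 6) (+-poly
  (+-poly (const-poly 4) (*-poly id-poly (const-poly 40)))
  (+-poly (const-poly 13) (+-poly (+-poly
    (*-poly id-poly (+-poly (const-poly 50) (budget-poly f))) (const-poly 4)) (const-poly 4))))

-- The algorithm

-- The share of an end at height g if the other end is at height h.  The
-- first summand is K for g ≤ h, and the second one is 0 for h ≤ g.
weight : (K g h : ℕ) → ℕ
weight K g h = (K ∸ (g ∸ h)) + (K ∸ (K ∸ (h ∸ g)))

weight≤ : ∀ K g h → weight K g h ≤ K + K
weight≤ K g h = ℕ.+-mono-≤ (ℕ.m∸n≤m K (g ∸ h)) (ℕ.m∸n≤m K (K ∸ (h ∸ g)))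

-- A comparison in disguise: for `d = x ∸ y` it adds 1 to `h` exactly if `y < x`. A program can
-- branch on `d` by testing it for `nil`.
raise : (d h : ℕ) → ℕ
raise zero    h = h
raise (suc d) h = suc h

module Dynamics (a : Fin n → Fin n → Bool) where

  load : ℕ → (Fin n → ℕ) → Fin n → ℕ
  load K p v = sum λ u → if a v u then weight K (p v) (p u) else 0

  climb : ℕ → (Fin n → ℕ) → Fin n → ℕ
  climb K p v = raise (K * load K p v ∸ p v) (p v)

  heights : ℕ → ℕ → Fin n → ℕ
  heights K zero    v = 0
  heights K (suc t) v = climb K (heights K t) v

  -- Refines the order of the heights p to a strict one.
  key : (Fin n → ℕ) → Fin n → ℕ
  key p v = (n ∸ suc (toℕ v)) + n * p v

  -- The number of neighbours of `v` in `F` at which `q` is larger than at `v`.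
  crowd : (Fin n → ℕ) → (Fin n → Bool) → Fin n → ℕ
  crowd q F v = sum λ u → if a v u then (if F u then raise (q u ∸ q v) 0 else 0) else 0

  grow : (Fin n → ℕ) → (Fin n → Bool) → Fin n → Bool
  grow q F v = crowd q F v ≤ᵇ 1

  -- All vertices are decided anew in each round.  As crowd only looks at
  -- larger keys, the decisions settle from the largest key downwards.
  chosen : (Fin n → ℕ) → ℕ → Fin n → Bool
  chosen q zero    v = false
  chosen q (suc t) v = grow q (chosen q t) v

-- The number K, a bound on the heights, and one on both the sum of the
-- heights and the keys.
scale ceiling rounds : ℕ → ℕ
scale n   = suc (n * (n * (n * 3)))
ceiling n = scale n * (n * (scale n + scale n))
rounds n  = suc (n * suc (ceiling n))

-- Unary numbers and vectors as trees

⌜_⌝ : ℕ → Tree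
⌜ zero ⌝  = nil
⌜ suc k ⌝ = nil ∙ ⌜ k ⌝

spine-⌜⌝ : ∀ k → spine ⌜ k ⌝ ≡ k
spine-⌜⌝ zero    = refl
spine-⌜⌝ (suc k) = cong suc (spine-⌜⌝ k)

right-⌜⌝ : ∀ k → right ⌜ k ⌝ ≡ ⌜ pred k ⌝
right-⌜⌝ zero    = refl
right-⌜⌝ (suc k) = refl

select : (c t e : Tree) → Tree
select nil     t e = e
select (_ ∙ _) t e = t

vec : (Fin n → Tree) → Tree
vec {zero}  f = nil
vec {suc n} f = f zero ∙ vec (f ∘ suc)

vec-cong : ∀ {f g : Fin n → Tree} → (∀ i → f i ≡ g i) → vec f ≡ vec g
vec-cong {zero}  p = refl
vec-cong {suc n} p = cong₂ _∙_ (p zero) (vec-cong (p ∘ suc))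

spine-vec : (f : Fin n → Tree) → spine (vec f) ≡ n
spine-vec {zero}  f = refl
spine-vec {suc n} f = cong suc (spine-vec (f ∘ suc))

encodeVec-lookup : ∀ {A : Set} (f : A → Tree) (v : Vec A n) → encodeVec f v ≡ vec (f ∘ lookup v)
encodeVec-lookup f []      = refl
encodeVec-lookup f (x ∷ v) = cong (f x ∙_) (encodeVec-lookup f v)

encodeVec-tabulate : ∀ {A : Set} (f : A → Tree) (g : Fin n → A) → encodeVec f (tabulate g) ≡ vec (f ∘ g)
encodeVec-tabulate {zero}  f g = refl
encodeVec-tabulate {suc n} f g = cong (f (g zero) ∙_) (encodeVec-tabulate f (g ∘ suc))

-- The algorithm as a program of folds

infixl 3 _▸_

_▸_ : ∀ {N f x y z} → Run N f x y → y ≡ z → Run N f x z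
r ▸ refl = r

-- The parts of the input of a fold body: the current elements of the two zipped lists, the
-- accumulator and the environment.
arg item item₁ item₂ acc env : Expr 1
arg   = var zero
item  = hd arg
item₁ = hd item
item₂ = tl item
acc   = hd (tl arg)
env   = tl (tl arg)

add mul monus choose : Fun
add = expr (cons (cons (hd arg) nil) (cons (tl arg) nil)) ⨟ fold (expr (cons nil acc))
mul = expr (cons (cons (hd arg) nil) (cons nil (tl arg))) ⨟ fold (expr (cons env acc) ⨟ add)
monus = expr (cons (cons (tl arg) nil) (cons (hd arg) nil)) ⨟ fold (expr (tl acc))
-- Branching is a fold over the condition: it starts from the else value, and any element of the
-- condition replaces this by the then value, which is the environment.
choose = expr (cons (cons (hd arg) nil) (cons (tl (tl arg)) (hd (tl arg)))) ⨟ fold (expr env)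

clip weigh : Fun
clip = expr (hd arg) & (expr (tl arg) ⨟ monus) ⨟ monus
weigh =
  clip &
  (expr (hd arg) & (expr (cons (hd arg) (cons (tl (tl arg)) (hd (tl arg)))) ⨟ clip) ⨟ monus)
  ⨟ add

loads climbBody climbStep climbing : Fun
loads = fold (
  expr item₂ &
  ((expr (cons (hd env) (cons (tl env) item₁)) ⨟ weigh) & expr acc ⨟ add) &
  expr acc
  ⨟ choose)
climbBody =
  ((expr (hd (tl env)) &
      (expr (cons (cons (hd env) item₂) (cons nil (cons (hd (tl env)) item₁))) ⨟ loads)
      ⨟ mul) &
    expr item₁ ⨟ monus) &
  expr (cons (cons nil item₁) item₁)
  ⨟ choose
climbStep =
  expr (cons (cons (hd arg) (tl (tl arg))) (cons nil arg)) ⨟ fold (climbBody & expr acc)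
climbing =
  (expr (cons (hd arg) nil) &
    (expr (cons (cons (tl (tl arg)) nil) (cons nil nil)) ⨟ fold (expr (cons nil acc))) &
    expr (tl arg))
  ⨟ fold (expr (tl arg) ⨟ climbStep)

keys crowds greedyBody greedyStep greedy : Fun
keys =
  expr (cons arg (cons nil (tl arg))) ⨟
  -- When a right fold comes to `v`, the accumulator holds one entry for each later vertex, so its
  -- length is the summand `n ∸ suc (toℕ v)` of the key. The rows in the environment serve as the
  -- factor `n`, and `nil` is the initial decision, false.
  fold (((expr acc & (expr (cons env item₁) ⨟ mul) ⨟ add) & expr nil) & expr acc)
crowds = fold (
  expr item₂ &
  (expr (tl item₁) &
    ((expr (cons (hd item₁) env) ⨟ monus) & expr (cons (cons nil acc) acc) ⨟ choose) &
    expr acc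
    ⨟ choose) &
  expr acc
  ⨟ choose)
greedyBody =
  expr (hd item₁) &
  -- The crowd is at most 1 if its predecessor is `nil`, and then the else value `nil ∙ nil` is
  -- taken, which encodes true.
  ((expr (cons (cons (hd env) item₂) (cons nil (hd item₁))) ⨟ crowds ⨟ expr (tl arg)) &
    expr (cons nil (cons nil nil))
    ⨟ choose)
greedyStep =
  expr (cons arg (cons nil arg)) ⨟ fold (greedyBody & expr acc)
greedy =
  expr (cons (cons (hd arg) nil) (tl arg)) ⨟ fold (expr (tl arg) ⨟ greedyStep)

-- An index outside the vertex set has no neighbours, so the greedy rounds choose it; here it is
-- removed again.
restrict : Fun
restrict =
  expr (cons arg (cons nil nil)) ⨟
  fold ((expr (cons item₁ (cons (tl item₂) nil)) ⨟ choose) & expr acc)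

-- The adjacency rows stand in for the number `n`, because `mul` reads its arguments only through
-- their lengths.
constants roundCount initial main : Fun
constants =
  ((expr (tl arg) &
    (expr (tl arg) &
      (expr (cons (tl arg) (cons nil (cons nil (cons nil nil)))) ⨟ mul) ⨟ mul) ⨟ mul)
    ⨟ expr (cons nil arg)) &
  expr (tl arg)
roundCount =
  expr (tl arg) &
  (expr (hd arg) &
    (expr (tl arg) & (expr (cons (hd arg) (hd arg)) ⨟ add) ⨟ mul) ⨟ mul
    ⨟ expr (cons nil arg))
  ⨟ mul ⨟ expr (cons nil arg)
initial = constants ⨟ roundCount & expr arg
main =
  expr (hd arg) &
  ((initial ⨟ expr (hd arg)) &
    (((initial ⨟ climbing) & expr (tl arg) ⨟ keys) & expr (tl arg))
    ⨟ greedy)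
  ⨟ restrict

-- Correctness of the program

module _ {N : ℕ} where

  ⌜⌝-bound : ∀ {k} → k ≤ N → spine ⌜ k ⌝ ≤ N
  ⌜⌝-bound {k} = subst (_≤ N) (sym (spine-⌜⌝ k))

  fold-suc : ∀ l {m e} b → FoldRun N (expr (cons nil acc)) e l m ⌜ b ⌝ ⌜ spine l + b ⌝
  fold-suc nil     b = []
  fold-suc (h ∙ l) b = expr ∷ fold-suc l b

  run-add : ∀ l b → spine l ≤ N → Run N add (l ∙ ⌜ b ⌝) ⌜ spine l + b ⌝
  run-add l b l≤ = expr ⨟ fold l≤ (fold-suc l b)

  run-add⌜⌝ : ∀ a b → a ≤ N → Run N add (⌜ a ⌝ ∙ ⌜ b ⌝) ⌜ a + b ⌝
  run-add⌜⌝ a b a≤ = run-add ⌜ a ⌝ b (⌜⌝-bound a≤) ▸ cong (λ k → ⌜ k + b ⌝) (spine-⌜⌝ a)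

  run-mul : ∀ l l′ → spine l ≤ N → spine l′ ≤ N → Run N mul (l ∙ l′) ⌜ spine l * spine l′ ⌝
  run-mul l l′ l≤ l′≤ = expr ⨟ fold l≤ (go l)
    where
    go : ∀ l {m} → FoldRun N (expr (cons env acc) ⨟ add) l′ l m nil ⌜ spine l * spine l′ ⌝
    go nil     = []
    go (h ∙ l) = (expr ⨟ run-add l′ (spine l * spine l′) l′≤) ∷ go l

  run-monus : ∀ a b → b ≤ N → Run N monus (⌜ a ⌝ ∙ ⌜ b ⌝) ⌜ a ∸ b ⌝
  run-monus a b b≤ = expr ⨟ fold (⌜⌝-bound b≤) (go b)
    where
    go : ∀ b {m e} → FoldRun N (expr (tl acc)) e ⌜ b ⌝ m ⌜ a ⌝ ⌜ a ∸ b ⌝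
    go zero    = []
    go (suc b) = (expr ▸ trans (right-⌜⌝ (a ∸ b)) (cong ⌜_⌝ (ℕ.pred[m∸n]≡m∸[1+n] a b))) ∷ go b

  run-mul⌜⌝ : ∀ a b → a ≤ N → b ≤ N → Run N mul (⌜ a ⌝ ∙ ⌜ b ⌝) ⌜ a * b ⌝
  run-mul⌜⌝ a b a≤ b≤ = run-mul ⌜ a ⌝ ⌜ b ⌝ (⌜⌝-bound a≤) (⌜⌝-bound b≤)
    ▸ cong ⌜_⌝ (cong₂ _*_ (spine-⌜⌝ a) (spine-⌜⌝ b))

  run-choose : ∀ c t e → spine c ≤ N → Run N choose (c ∙ (t ∙ e)) (select c t e)
  run-choose c t e c≤ = expr ⨟ fold c≤ (go c)
    where
    go : ∀ c {m} → FoldRun N (expr env) t c m e (select c t e)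
    go nil     = []
    go (h ∙ c) = expr ∷ go c

  run-clip : ∀ K a b → a ≤ N → b ≤ N → Run N clip (⌜ K ⌝ ∙ (⌜ a ⌝ ∙ ⌜ b ⌝)) ⌜ K ∸ (a ∸ b) ⌝
  run-clip K a b a≤ b≤ =
    expr & (expr ⨟ run-monus a b b≤) ⨟ run-monus K (a ∸ b) (ℕ.≤-trans (ℕ.m∸n≤m a b) a≤)

  run-weigh : ∀ K a b → K ≤ N → a ≤ N → b ≤ N →
    Run N weigh (⌜ K ⌝ ∙ (⌜ a ⌝ ∙ ⌜ b ⌝)) ⌜ weight K a b ⌝
  run-weigh K a b K≤ a≤ b≤ =
    run-clip K a b a≤ b≤ &
    (expr & (expr ⨟ run-clip K b a b≤ a≤) ⨟ run-monus K c (ℕ.≤-trans (ℕ.m∸n≤m K (b ∸ a)) K≤)) ⨟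
    run-add⌜⌝ (K ∸ (a ∸ b)) (K ∸ c) (ℕ.≤-trans (ℕ.m∸n≤m K (a ∸ b)) K≤)
    where
    c : ℕ
    c = K ∸ (b ∸ a)

  -- The body may rely on the length of the accumulator, the number of entries after `i`, from which
  -- `keys` breaks ties.
  fold-map : ∀ {b e} {f g h : Fin n → Tree} →
    (∀ i acc → spine acc ≡ n ∸ suc (toℕ i) → Run N b ((f i ∙ g i) ∙ (acc ∙ e)) (h i ∙ acc)) →
    FoldRun N b e (vec f) (vec g) nil (vec h)
  fold-map {zero}  r = []
  fold-map {suc n} r = r zero _ (spine-vec _) ∷ fold-map (r ∘ suc)

  fold-sum : ∀ {b e} {f g : Fin n → Tree} {w : Fin n → ℕ} →
    (∀ i k → Run N b ((f i ∙ g i) ∙ (⌜ k ⌝ ∙ e)) ⌜ w i + k ⌝) →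
    FoldRun N b e (vec f) (vec g) nil ⌜ sum w ⌝
  fold-sum {zero}  r = []
  fold-sum {suc n} r = r zero _ ∷ fold-sum (r ∘ suc)

  -- A unary number is a list whose elements carry nothing, so that a fold over it is bounded
  -- iteration.
  fold-iterate : ∀ {b e} (A : ℕ → Tree) →
    (∀ t → Run N b ((nil ∙ nil) ∙ (A t ∙ e)) (A (suc t))) →
    ∀ t → FoldRun N b e ⌜ t ⌝ nil (A 0) (A t)
  fold-iterate A r zero    = []
  fold-iterate A r (suc t) = r t ∷ fold-iterate A r t

select-encodeBool : ∀ b (k l : ℕ) → select (encodeBool b) ⌜ k ⌝ ⌜ l ⌝ ≡ ⌜ if b then k else l ⌝
select-encodeBool true  k l = refl
select-encodeBool false k l = refl

select-raise : ∀ d h → select ⌜ d ⌝ (nil ∙ ⌜ h ⌝) ⌜ h ⌝ ≡ ⌜ raise d h ⌝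
select-raise zero    h = refl
select-raise (suc d) h = refl

raise-+ : ∀ d k → raise d k ≡ raise d 0 + k
raise-+ zero    k = refl
raise-+ (suc d) k = refl

if-+ : ∀ b k l → (if b then k + l else l) ≡ (if b then k else 0) + l
if-+ true  k l = refl
if-+ false k l = refl

encodeBool-bound : ∀ b {N} → 1 ≤ N → spine (encodeBool b) ≤ N
encodeBool-bound true  1≤N = 1≤N
encodeBool-bound false 1≤N = z≤n

module Execution (a : Fin n → Fin n → Bool) {N : ℕ} (1≤N : 1 ≤ N) (n≤N : n ≤ N) where
  open Dynamics a

  row : Fin n → Tree
  row v = vec (encodeBool ∘ a v)

  rows : Tree
  rows = vec row

  vec-bound : (f : Fin n → Tree) → spine (vec f) ≤ N
  vec-bound f = subst (_≤ N) (sym (spine-vec f)) n≤N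

  numbers : (Fin n → ℕ) → Tree
  numbers p = vec (⌜_⌝ ∘ p)

  module _ {K : ℕ} (w≤N : K + K ≤ N) where

    K≤N : K ≤ N
    K≤N = ℕ.≤-trans (ℕ.m≤m+n K K) w≤N

    run-loads : ∀ p v → (∀ u → p u ≤ N) →
      Run N loads ((numbers p ∙ row v) ∙ (nil ∙ (⌜ K ⌝ ∙ ⌜ p v ⌝))) ⌜ load K p v ⌝
    run-loads p v p≤ = fold (vec-bound _) (fold-sum λ u k →
      let w = weight K (p v) (p u) in
      expr &
      ((expr ⨟ run-weigh K (p v) (p u) K≤N (p≤ v) (p≤ u)) & expr ⨟
        run-add⌜⌝ w k (ℕ.≤-trans (weight≤ K (p v) (p u)) w≤N)) &
      expr
      ⨟ (run-choose _ _ _ (encodeBool-bound (a v u) 1≤N)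
          ▸ trans (select-encodeBool (a v u) (w + k) k) (cong ⌜_⌝ (if-+ (a v u) w k))))

    run-climbBody : ∀ p v acc → (∀ u → p u ≤ N) → load K p v ≤ N → K * load K p v ≤ N →
      Run N climbBody ((⌜ p v ⌝ ∙ row v) ∙ (acc ∙ (numbers p ∙ (⌜ K ⌝ ∙ rows)))) ⌜ climb K p v ⌝
    run-climbBody p v acc p≤ load≤ Kload≤ =
      ((expr & (expr ⨟ run-loads p v p≤) ⨟ run-mul⌜⌝ K (load K p v) K≤N load≤) & expr ⨟
        run-monus (K * load K p v) (p v) (p≤ v)) &
      expr
      ⨟ (run-choose _ _ _ (⌜⌝-bound (ℕ.≤-trans (ℕ.m∸n≤m (K * load K p v) (p v)) Kload≤))
          ▸ select-raise (K * load K p v ∸ p v) (p v))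

    run-climbStep : ∀ p → (∀ v → p v ≤ N) → (∀ v → load K p v ≤ N) → (∀ v → K * load K p v ≤ N) →
      Run N climbStep (numbers p ∙ (⌜ K ⌝ ∙ rows)) (numbers (climb K p))
    run-climbStep p p≤ load≤ Kload≤ =
      expr ⨟ fold (vec-bound _) (fold-map λ v acc _ →
        run-climbBody p v acc p≤ (load≤ v) (Kload≤ v) & expr)

    run-climbing : (∀ t v → heights K t v ≤ N) → (∀ p v → K * load K p v ≤ N) → (∀ p v → load K p v ≤ N) →
      ∀ t → t ≤ N → Run N climbing (⌜ t ⌝ ∙ (⌜ K ⌝ ∙ rows)) (numbers (heights K t))
    run-climbing heights≤ Kload≤ load≤ t t≤ =
      expr & (expr ⨟ fold (vec-bound _) (zeros n row)) & expr ⨟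
      fold (⌜⌝-bound t≤) (fold-iterate (λ i → numbers (heights K i))
        (λ i → expr ⨟ run-climbStep (heights K i) (heights≤ i) (load≤ (heights K i)) (Kload≤ (heights K i))) t)
      where
      zeros : ∀ m (f : Fin m → Tree) {l e} →
              FoldRun N (expr (cons nil acc)) e (vec f) l nil (vec {m} λ _ → nil)
      zeros zero    f = []
      zeros (suc m) f = expr ∷ zeros m (f ∘ suc)

  state : (Fin n → ℕ) → (Fin n → Bool) → Tree
  state q F = vec λ v → ⌜ q v ⌝ ∙ encodeBool (F v)

  run-keys : ∀ p → (∀ v → p v ≤ N) → Run N keys (numbers p ∙ rows) (state (key p) λ _ → false)
  run-keys p p≤ = expr ⨟ fold (vec-bound _) (fold-map λ v acc eq →
    ((expr & (expr ⨟ run-mul rows ⌜ p v ⌝ (vec-bound _) (⌜⌝-bound (p≤ v))) ⨟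
      run-add acc (spine rows * spine ⌜ p v ⌝)
        (subst (_≤ N) (sym eq) (ℕ.≤-trans (ℕ.m∸n≤m n (suc (toℕ v))) n≤N))
      ▸ cong ⌜_⌝ (cong₂ _+_ eq (cong₂ _*_ (spine-vec row) (spine-⌜⌝ (p v))))) & expr) & expr)

  run-crowds : ∀ q F v → (∀ u → q u ≤ N) →
    Run N crowds ((state q F ∙ row v) ∙ (nil ∙ ⌜ q v ⌝)) ⌜ crowd q F v ⌝
  run-crowds q F v q≤ = fold (vec-bound _) (fold-sum λ u k →
    let d = q u ∸ q v in
    expr &
    (expr &
      ((expr ⨟ run-monus (q u) (q v) (q≤ v)) & expr
        ⨟ (run-choose _ _ _ (⌜⌝-bound (ℕ.≤-trans (ℕ.m∸n≤m (q u) (q v)) (q≤ u)))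
            ▸ trans (select-raise d k) (cong ⌜_⌝ (raise-+ d k)))) &
      expr
      ⨟ (run-choose _ _ _ (encodeBool-bound (F u) 1≤N)
          ▸ trans (select-encodeBool (F u) _ k) (cong ⌜_⌝ (if-+ (F u) _ k)))) &
    expr
    ⨟ (run-choose _ _ _ (encodeBool-bound (a v u) 1≤N)
        ▸ trans (select-encodeBool (a v u) _ k) (cong ⌜_⌝ (if-+ (a v u) _ k))))

  run-greedyBody : ∀ q F v {acc} → (∀ u → q u ≤ N) → crowd q F v ≤ N →
    Run N greedyBody (((⌜ q v ⌝ ∙ encodeBool (F v)) ∙ row v) ∙ (acc ∙ (state q F ∙ rows)))
                     (⌜ q v ⌝ ∙ encodeBool (grow q F v))
  run-greedyBody q F v q≤ crowd≤ =
    expr &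
    ((expr ⨟ run-crowds q F v q≤ ⨟ expr ▸ right-⌜⌝ (crowd q F v)) & expr
      ⨟ (run-choose _ _ _ (⌜⌝-bound (ℕ.≤-trans (ℕ.m∸n≤m (crowd q F v) 1) crowd≤)) ▸ few (crowd q F v)))
    where
    few : ∀ k → select ⌜ pred k ⌝ nil (nil ∙ nil) ≡ encodeBool (k ≤ᵇ 1)
    few 0             = refl
    few 1             = refl
    few (suc (suc k)) = refl

  run-greedyStep : ∀ q F → (∀ u → q u ≤ N) → (∀ v → crowd q F v ≤ N) →
    Run N greedyStep (state q F ∙ rows) (state q (grow q F))
  run-greedyStep q F q≤ crowd≤ = expr ⨟ fold (vec-bound _) (fold-map λ v acc _ →
    run-greedyBody q F v q≤ (crowd≤ v) & expr)

  run-greedy : ∀ q → (∀ u → q u ≤ N) → (∀ F v → crowd q F v ≤ N) → ∀ t → t ≤ N →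
    Run N greedy (⌜ t ⌝ ∙ (state q (λ _ → false) ∙ rows)) (state q (chosen q t))
  run-greedy q q≤ crowd≤ t t≤ = expr ⨟ fold (⌜⌝-bound t≤) (fold-iterate
    (λ i → state q (chosen q i)) (λ i → expr ⨟ run-greedyStep q (chosen q i) q≤ (crowd≤ (chosen q i))) t)

  run-restrict : ∀ (V : Fin n → Bool) q F →
    Run N restrict (vec (encodeBool ∘ V) ∙ state q F) (vec λ v → encodeBool (V v ∧ F v))
  run-restrict V q F = expr ⨟ fold (vec-bound _) (fold-map λ v _ _ →
    (expr ⨟ run-choose _ _ _ (encodeBool-bound (V v) 1≤N) ▸ select-∧ (V v) (F v)) & expr)
    where
    select-∧ : ∀ b c → select (encodeBool b) (encodeBool c) nil ≡ encodeBool (b ∧ c)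
    select-∧ true  c = refl
    select-∧ false c = refl

-- Balancing the loads

χ : Bool → ℕ
χ b = if b then 1 else 0

sum-mono : {f g : Fin n → ℕ} → (∀ i → f i ≤ g i) → sum f ≤ sum g
sum-mono {zero}  f≤g = z≤n
sum-mono {suc n} f≤g = ℕ.+-mono-≤ (f≤g zero) (sum-mono (f≤g ∘ suc))

sum-≤ : ∀ c {f : Fin n → ℕ} → (∀ i → f i ≤ c) → sum f ≤ n * c
sum-≤ {zero}  c f≤c = z≤n
sum-≤ {suc n} c f≤c = ℕ.+-mono-≤ (f≤c zero) (sum-≤ c (f≤c ∘ suc))

-- With `x` and `y` the first summands at the two ends, the shares are `x + (K ∸ y)` and
-- `y + (K ∸ x)`.
weight-sym : ∀ K g h → weight K g h + weight K h g ≡ K + K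
weight-sym K g h = trans (lemma x y (K ∸ x) (K ∸ y))
  (cong₂ _+_ (ℕ.m+[n∸m]≡n (ℕ.m∸n≤m K (g ∸ h))) (ℕ.m+[n∸m]≡n (ℕ.m∸n≤m K (h ∸ g))))
  where
  x y : ℕ
  x = K ∸ (g ∸ h)
  y = K ∸ (h ∸ g)

  lemma : ∀ x y x′ y′ → (x + y′) + (y + x′) ≡ (x + x′) + (y + y′)
  lemma = solve-∀

weight-≥ : ∀ K {g h} → g ≤ h → K ≤ weight K g h
weight-≥ K {g} {h} g≤h rewrite ℕ.m≤n⇒m∸n≡0 g≤h = ℕ.m≤m+n K _

weight-0 : ∀ K {g h} → h + K ≤ g → weight K g h ≡ 0
weight-0 K {g} {h} h+K≤g
  rewrite ℕ.m≤n⇒m∸n≡0 (ℕ.m+n≤o⇒m≤o h h+K≤g) | ℕ.n∸n≡0 K =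
  trans (ℕ.+-identityʳ _) (ℕ.m≤n⇒m∸n≡0 (ℕ.m+n≤o⇒m≤o∸n K (subst (_≤ g) (ℕ.+-comm h K) h+K≤g)))

weight-monoʳ : ∀ K g {h h′} → h ≤ h′ → weight K g h ≤ weight K g h′
weight-monoʳ K g h≤h′ = ℕ.+-mono-≤
  (ℕ.∸-monoʳ-≤ K (ℕ.∸-monoʳ-≤ g h≤h′))
  (ℕ.∸-monoʳ-≤ K (ℕ.∸-monoʳ-≤ K (ℕ.∸-monoˡ-≤ g h≤h′)))

∸-slope : ∀ K {x y} → y ≤ suc x → K ∸ x ≤ suc (K ∸ y)
∸-slope K {x} {y} y≤1+x = ℕ.m≤n+o⇒m∸n≤o K x (begin
  K                    ≤⟨ ℕ.m≤n+m∸n K y ⟩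
  y + (K ∸ y)          ≤⟨ ℕ.+-monoˡ-≤ (K ∸ y) y≤1+x ⟩
  suc x + (K ∸ y)      ≡⟨ ℕ.+-suc x (K ∸ y) ⟨
  x + suc (K ∸ y)      ∎)

suc-∸ : ∀ g h → suc g ∸ h ≤ suc (g ∸ h)
suc-∸ g       zero    = ℕ.≤-refl
suc-∸ zero    (suc h) = ℕ.≤-trans (ℕ.m∸n≤m 0 h) z≤n
suc-∸ (suc g) (suc h) = suc-∸ g h

-- The own height enters each of the two summands through truncated differences, which move by at
-- most 1 per unit.
weight-slope : ∀ K g h → weight K g h ≤ weight K (suc g) h + 2
weight-slope K g h = begin
  weight K g h               ≤⟨ ℕ.+-mono-≤ (∸-slope K (suc-∸ g h))
                                  (∸-slope K (∸-slope K (∸-slope h ℕ.≤-refl))) ⟩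
  suc x + suc y              ≡⟨ lemma x y ⟩
  weight K (suc g) h + 2     ∎
  where
  x y : ℕ
  x = K ∸ (suc g ∸ h)
  y = K ∸ (K ∸ (h ∸ suc g))

  lemma : ∀ x y → suc x + suc y ≡ x + y + 2
  lemma = solve-∀

raise-≥ : ∀ d h → h ≤ raise d h
raise-≥ zero    h = ℕ.≤-refl
raise-≥ (suc d) h = ℕ.n≤1+n h

raise-fixed : ∀ d h → raise d h ≡ h → d ≡ 0
raise-fixed zero    h _  = refl
raise-fixed (suc d) h eq = contradiction eq ℕ.1+n≢n

module Heights (a : Fin n → Fin n → Bool) (K : ℕ) where
  open Dynamics a

  top : ℕ
  top = K * (n * (K + K))

  load≤ : ∀ p v → load K p v ≤ n * (K + K)
  load≤ p v = sum-≤ (K + K) λ u → lemma (a v u) u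
    where
    lemma : ∀ b u → (if b then weight K (p v) (p u) else 0) ≤ K + K
    lemma true  u = weight≤ K (p v) (p u)
    lemma false u = z≤n

  Kload≤ : ∀ p v → K * load K p v ≤ top
  Kload≤ p v = ℕ.*-monoʳ-≤ K (load≤ p v)

  -- A vertex moves only while it is below `K * load`, and this never exceeds `top`.
  heights≤ : ∀ t v → heights K t v ≤ top
  heights≤ zero    v = z≤n
  heights≤ (suc t) v with K * load K (heights K t) v ∸ heights K t v in eq
  ... | zero  = heights≤ t v
  ... | suc d = ℕ.≤-trans
    (ℕ.m∸n≢0⇒n<m λ eq′ → ℕ.1+n≢0 (trans (sym eq) eq′)) (Kload≤ (heights K t) v)

  load-monoʳ : ∀ {p p′} v → p v ≡ p′ v → (∀ u → p u ≤ p′ u) → load K p v ≤ load K p′ v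
  load-monoʳ {p} {p′} v eq p≤p′ = sum-mono λ u → lemma (a v u) u
    where
    lemma : ∀ b u → (if b then weight K (p v) (p u) else 0) ≤ (if b then weight K (p′ v) (p′ u) else 0)
    lemma true  u rewrite eq = weight-monoʳ K (p′ v) (p≤p′ u)
    lemma false u = z≤n

  load-slope : ∀ {p p′} v → p′ v ≡ suc (p v) → (∀ u → p u ≤ p′ u) → load K p v ≤ load K p′ v + n * 2
  load-slope {p} {p′} v eq p≤p′ = begin
    load K p v                                    ≤⟨ sum-mono (λ u → lemma (a v u) u) ⟩
    sum (λ u → f u + 2)                           ≡⟨ ∑-distrib-+ f (λ _ → 2) ⟩
    load K p′ v + sum {n} (λ _ → 2)               ≤⟨ ℕ.+-monoʳ-≤ (load K p′ v) (sum-≤ {n} 2 λ _ → ℕ.≤-refl) ⟩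
    load K p′ v + n * 2                           ∎
    where
    f : Fin n → ℕ
    f u = if a v u then weight K (p′ v) (p′ u) else 0

    lemma : ∀ b u → (if b then weight K (p v) (p u) else 0) ≤ (if b then weight K (p′ v) (p′ u) else 0) + 2
    lemma true  u rewrite eq = ℕ.≤-trans (weight-slope K (p v) (p u))
      (ℕ.+-monoˡ-≤ 2 (weight-monoʳ K (suc (p v)) (p≤p′ u)))
    lemma false u = z≤n

  climb-≥ : ∀ p v → p v ≤ climb K p v
  climb-≥ p v = raise-≥ (K * load K p v ∸ p v) (p v)

  -- Invariant of a round. If `v` stays, the others can only rise, and its load does not fall. If
  -- `v` rises, it was below `K * load`, and its own step costs it at most 2 on each of at most `n`
  -- edges.
  heights≤Kload : ∀ t v → heights K t v ≤ K * load K (heights K t) v + K * (n * 2)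
  heights≤Kload zero    v = z≤n
  heights≤Kload (suc t) v = go (K * load K p v ∸ p v) refl
    where
    p : Fin n → ℕ
    p = heights K t

    go : ∀ d → K * load K p v ∸ p v ≡ d → climb K p v ≤ K * load K (climb K p) v + K * (n * 2)
    go zero eq = begin
      climb K p v                                  ≡⟨ same ⟩
      p v                                          ≤⟨ heights≤Kload t v ⟩
      K * load K p v + K * (n * 2)                 ≤⟨ ℕ.+-monoˡ-≤ (K * (n * 2)) (ℕ.*-monoʳ-≤ K
                                                        (load-monoʳ v (sym same) (climb-≥ p))) ⟩
      K * load K (climb K p) v + K * (n * 2)       ∎
      where
      same : climb K p v ≡ p v
      same = cong (λ d → raise d (p v)) eq
    go (suc d) eq = begin
      climb K p v                                  ≡⟨ up ⟩
      suc (p v)                                    ≤⟨ ℕ.m∸n≢0⇒n<m (λ eq′ → ℕ.1+n≢0 (trans (sym eq) eq′)) ⟩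
      K * load K p v                               ≤⟨ ℕ.*-monoʳ-≤ K (load-slope v up (climb-≥ p)) ⟩
      K * (load K (climb K p) v + n * 2)           ≡⟨ ℕ.*-distribˡ-+ K _ (n * 2) ⟩
      K * load K (climb K p) v + K * (n * 2)       ∎
      where
      up : climb K p v ≡ suc (p v)
      up = cong (λ d → raise d (p v)) eq

  load-cong : ∀ {p p′} → p ≗ p′ → ∀ v → load K p v ≡ load K p′ v
  load-cong p≗p′ v = sum-cong-≗ λ u → cong₂ (λ g h → if a v u then weight K g h else 0) (p≗p′ v) (p≗p′ u)

  climb-cong : ∀ {p p′} → p ≗ p′ → climb K p ≗ climb K p′
  climb-cong p≗p′ v = cong₂ raise (cong₂ _∸_ (cong (K *_) (load-cong p≗p′ v)) (p≗p′ v)) (p≗p′ v)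

  sum-strict : ∀ {m} {p p′ : Fin m → ℕ} → (∀ u → p u ≤ p′ u) → ∀ v → p v < p′ v → sum p < sum p′
  sum-strict p≤p′ zero    lt = ℕ.+-mono-<-≤ lt (sum-mono (p≤p′ ∘ suc))
  sum-strict p≤p′ (suc v) lt = ℕ.+-mono-≤-< (p≤p′ zero) (sum-strict (p≤p′ ∘ suc) v lt)

  -- A round that moves some vertex adds at least 1 to the total height, and a fixed point is never
  -- left.
  progress : ∀ t → climb K (heights K t) ≗ heights K t ⊎ t ≤ sum (heights K t)
  progress zero    = inj₂ z≤n
  progress (suc t) with progress t | Fin.all? (λ v → climb K (heights K t) v ℕ.≟ heights K t v)
  ... | inj₁ fixed | _         = inj₁ (climb-cong fixed)
  ... | inj₂ t≤    | yes fixed = inj₁ (climb-cong fixed)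
  ... | inj₂ t≤    | no ¬fixed with Fin.¬∀⟶∃¬ n _ (λ v → climb K (heights K t) v ℕ.≟ heights K t v) ¬fixed
  ... | v , ≢ = inj₂ (ℕ.≤-<-trans t≤ (sum-strict (climb-≥ _) v (ℕ.≤∧≢⇒< (climb-≥ (heights K t) v) (≢ ∘ sym))))

  -- The total height is at most `n * top`, so after more rounds than that a fixed point is reached;
  -- there no vertex is below `K * load`.
  Kload≤heights : ∀ {t} → n * top < t → ∀ v → K * load K (heights K t) v ≤ heights K t v
  Kload≤heights {t} big v with progress t
  ... | inj₁ fixed = ℕ.m∸n≡0⇒m≤n (raise-fixed _ _ (fixed v))
  ... | inj₂ t≤    = contradiction (ℕ.<-≤-trans big (ℕ.≤-trans t≤ (sum-≤ top (heights≤ t)))) (ℕ.<-irrefl refl)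

-- Keys and the greedy choice

module Keys (a : Fin n → Fin n → Bool) (p : Fin n → ℕ) where
  open Dynamics a

  -- The tie-break is less than `n`, the gain in key from one unit of height.
  key-mono : ∀ u v → p u < p v → key p u < key p v
  key-mono u v lt = begin-strict
    (n ∸ suc (toℕ u)) + n * p u   <⟨ ℕ.+-monoˡ-< (n * p u) (ℕ.m<n+o⇒m∸n<o n (suc (toℕ u)) {{Fin.nonZeroIndex u}} (s≤s (ℕ.m≤n+m n (toℕ u)))) ⟩
    n + n * p u                   ≡⟨ ℕ.*-suc n (p u) ⟨
    n * suc (p u)                 ≤⟨ ℕ.*-monoʳ-≤ n lt ⟩
    n * p v                       ≤⟨ ℕ.m≤n+m (n * p v) _ ⟩
    key p v                       ∎

  key-reflects : ∀ u v → key p u ≤ key p v → p u ≤ p v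
  key-reflects u v le = ℕ.≮⇒≥ λ lt → ℕ.<⇒≱ (key-mono v u lt) le

  key-injective : ∀ u v → key p u ≡ key p v → u ≡ v
  key-injective u v eq = Fin.toℕ-injective (ℕ.suc-injective
    (ℕ.∸-cancelˡ-≡ (Fin.toℕ<n u) (Fin.toℕ<n v)
      (ℕ.+-cancelʳ-≡ (n * p v) _ _ (subst (λ h → n ∸ suc (toℕ u) + n * h ≡ key p v) p≡ eq))))
    where
    p≡ : p u ≡ p v
    p≡ = ℕ.≤-antisym (key-reflects u v (ℕ.≤-reflexive eq)) (key-reflects v u (ℕ.≤-reflexive (sym eq)))

  key< : ∀ {B} → (∀ v → p v ≤ B) → ∀ v → key p v < suc (n * suc B)
  key< {B} p≤ v = s≤s (begin
    (n ∸ suc (toℕ v)) + n * p v  ≤⟨ ℕ.+-mono-≤ (ℕ.m∸n≤m n (suc (toℕ v))) (ℕ.*-monoʳ-≤ n (p≤ v)) ⟩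
    n + n * B                    ≡⟨ ℕ.*-suc n B ⟨
    n * suc B                    ∎)

module Greedy (a : Fin n → Fin n → Bool) (q : Fin n → ℕ) where
  open Dynamics a

  crowd≤ : ∀ F v → crowd q F v ≤ n
  crowd≤ F v = ℕ.≤-trans (sum-≤ 1 λ u → lemma (a v u) (F u) (q u ∸ q v)) (ℕ.≤-reflexive (ℕ.*-identityʳ n))
    where
    lemma : ∀ b c d → (if b then (if c then raise d 0 else 0) else 0) ≤ 1
    lemma true  true  zero    = z≤n
    lemma true  true  (suc d) = s≤s z≤n
    lemma true  false d       = z≤n
    lemma false c     d       = z≤n

  crowd-cong : ∀ {F F′} v → (∀ u → q v < q u → F u ≡ F′ u) → crowd q F v ≡ crowd q F′ v
  crowd-cong {F} {F′} v F≡F′ = sum-cong-≗ λ u → cong (λ k → if a v u then k else 0) (lemma u (q u ∸ q v) refl)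
    where
    if-0 : ∀ b → (if b then 0 else 0) ≡ 0
    if-0 true  = refl
    if-0 false = refl

    lemma : ∀ u d → q u ∸ q v ≡ d → (if F u then raise d 0 else 0) ≡ (if F′ u then raise d 0 else 0)
    lemma u zero    eq = trans (if-0 (F u)) (sym (if-0 (F′ u)))
    lemma u (suc d) eq = cong (λ b → if b then 1 else 0)
      (F≡F′ u (ℕ.m∸n≢0⇒n<m λ eq′ → ℕ.1+n≢0 (trans (sym eq) eq′)))

  -- Induction on `t`: after `t` rounds all keys from `R ∸ t` upwards are settled, since `crowd` at
  -- `v` depends only on larger keys, which were settled a round earlier. For `t = 0` there are no
  -- such keys.
  chosen-stable : ∀ {R} → (∀ v → q v < R) → ∀ t v → R ≤ q v + t → chosen q (suc t) v ≡ chosen q t v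
  chosen-stable q< zero    v R≤ = contradiction (q< v) (ℕ.≤⇒≯ (subst (_ ≤_) (ℕ.+-identityʳ (q v)) R≤))
  chosen-stable q< (suc t) v R≤ = cong (_≤ᵇ 1) (crowd-cong v λ u lt →
    chosen-stable q< t u (ℕ.≤-trans R≤ (subst (_≤ q u + t) (sym (ℕ.+-suc (q v) t)) (ℕ.+-monoˡ-≤ t lt))))

  chosen-fixed : ∀ {R} → (∀ v → q v < R) → grow q (chosen q R) ≗ chosen q R
  chosen-fixed {R} q< v = chosen-stable q< R v (ℕ.m≤n+m R (q v))

open Dynamics using (load; crowd; grow)

-- Loads and densities

T⇒∈ : ∀ {S : Subset n} {v} → T (lookup S v) → v ∈ S
T⇒∈ {S = S} {v} t = lookup⇒[]= v S (Equivalence.to T-≡ t)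

∈⇒T : ∀ {S : Subset n} {v} → v ∈ S → T (lookup S v)
∈⇒T v∈S = Equivalence.from T-≡ ([]=⇒lookup v∈S)

∣∣≡sum : (S : Subset n) → ∣ S ∣ ≡ sum (χ ∘ lookup S)
∣∣≡sum []            = refl
∣∣≡sum (inside  ∷ S) = cong suc (∣∣≡sum S)
∣∣≡sum (outside ∷ S) = ∣∣≡sum S

sum-χ-const : ∀ (S : Subset n) c → sum (λ v → χ (lookup S v) * c) ≡ ∣ S ∣ * c
sum-χ-const S c = trans (sym (*-distribʳ-sum c (χ ∘ lookup S))) (cong (_* c) (sym (∣∣≡sum S)))

arcs : Graph n → ℕ
arcs G = sum λ u → sum λ v → χ (adj G u v)

-- The loads are summed twice, the second time with the ends of every arc exchanged. The two shares
-- on an arc then add up to `K + K`.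
sum-load : (G : Graph n) → ∀ K p → sum (load (adj G) K p) ≡ K * arcs G
sum-load G K p = ℕ.*-cancelˡ-≡ _ _ 2 (begin-equality
  2 * L                                                      ≡⟨ cong (_+_ L) (ℕ.+-identityʳ L) ⟩
  L + L                                                      ≡⟨ cong (_+_ L) (∑-comm f) ⟩
  L + sum (λ v → sum λ u → f u v)                            ≡⟨ ∑-distrib-+ (λ u → sum (f u)) (λ v → sum λ u → f u v) ⟨
  sum (λ u → sum (f u) + sum (λ v → f v u))                  ≡⟨ sum-cong-≗ (λ u → ∑-distrib-+ (f u) (λ v → f v u)) ⟨
  sum (λ u → sum λ v → f u v + f v u)                        ≡⟨ sum-cong-≗ (λ u → sum-cong-≗ λ v → both u v) ⟩
  sum (λ u → sum λ v → (K + K) * χ (adj G u v))              ≡⟨ sum-cong-≗ (λ u → *-distribˡ-sum (K + K) (χ ∘ adj G u)) ⟨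
  sum (λ u → (K + K) * sum λ v → χ (adj G u v))              ≡⟨ *-distribˡ-sum (K + K) (λ u → sum λ v → χ (adj G u v)) ⟨
  (K + K) * arcs G                                           ≡⟨ lemma K (arcs G) ⟩
  2 * (K * arcs G)                                           ∎)
  where
  f : Fin _ → Fin _ → ℕ
  f u v = if adj G u v then weight K (p u) (p v) else 0

  L : ℕ
  L = sum (load (adj G) K p)

  lemma : ∀ K e → (K + K) * e ≡ 2 * (K * e)
  lemma = solve-∀

  both : ∀ u v → f u v + f v u ≡ (K + K) * χ (adj G u v)
  both u v rewrite symmetric G v u with adj G u v
  ... | true  = trans (weight-sym K (p u) (p v)) (sym (ℕ.*-identityʳ (K + K)))
  ... | false = sym (ℕ.*-zeroʳ (K + K))

¬T⇒false : ∀ {b} → ¬ T b → b ≡ false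
¬T⇒false {true}  ¬t = contradiction _ ¬t
¬T⇒false {false} ¬t = refl

if-≤ : ∀ b k → (if b then k else 0) ≤ k
if-≤ true  k = ℕ.≤-refl
if-≤ false k = z≤n

-- Each strict inclusion adds an element, and `n` of them on top of a nonempty set would need more
-- than `n` elements.
chain-stalls : (A : ℕ → Subset n) → (∀ j → A j ⊆ A (suc j)) → Nonempty (A 0) →
               ∃[ j ] j < n × A (suc j) ⊆ A j
chain-stalls {n} A A⊆ (x , x∈) with go n
  where
  go : ∀ m → (∃[ j ] j < m × A (suc j) ⊆ A j) ⊎ m < ∣ A m ∣
  go zero = inj₂ (ℕ.≤-<-trans z≤n (x∈p⇒∣p-x∣<∣p∣ x∈))
  go (suc m) with go m | A m ⊂? A (suc m)
  ... | inj₁ (j , j<m , ⊇) | _ = inj₁ (j , ℕ.m<n⇒m<1+n j<m , ⊇)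
  ... | inj₂ m<            | yes ⊂ = inj₂ (ℕ.≤-<-trans m< (p⊂q⇒∣p∣<∣q∣ ⊂))
  ... | inj₂ m<            | no ¬⊂ = inj₁ (m , ℕ.n<1+n m , ⊇)
    where
    ⊇ : A (suc m) ⊆ A m
    ⊇ {y} y∈ with y ∈? A m
    ... | yes y∈A = y∈A
    ... | no  y∉A = ⊥-elim (¬⊂ (A⊆ m , y , y∈ , y∉A))
... | inj₁ stall = stall
... | inj₂ n<    = contradiction (∣p∣≤n (A n)) (ℕ.<⇒≱ n<)

module _ (G : Graph n) (K s : ℕ) (p : Fin n → ℕ) (p≤ : ∀ v → p v ≤ K * load (adj G) K p v + s) where

  -- A is the set of vertices at height at least p v - j * K, where j is chosen
  -- such that no vertex is less than K below it.
  height≤density : ∀ {v} → v ∈ vertices G → ∃[ A ] Nonempty (vertices (G [ A ])) ×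
    ∣ vertices (G [ A ]) ∣ * p v ≤ K * (K * arcs (G [ A ])) + ∣ vertices (G [ A ]) ∣ * (s + n * K)
  height≤density {v} v∈V = A j , (v , D∋ v∈V (ℕ.m≤m+n (p v) (j * K))) , (begin
    ∣ D ∣ * p v                                              ≡⟨ sum-χ-const D (p v) ⟨
    sum (λ u → χ (lookup D u) * p v)                         ≤⟨ sum-mono pointwise ⟩
    sum (λ u → K * load (adj H) K p u + χ (lookup D u) * c)  ≡⟨ ∑-distrib-+ (λ u → K * load (adj H) K p u) _ ⟩
    sum (λ u → K * load (adj H) K p u) + sum (λ u → χ (lookup D u) * c)
      ≡⟨ cong₂ _+_ (trans (sym (*-distribˡ-sum K (load (adj H) K p))) (cong (K *_) (sum-load H K p))) (sum-χ-const D c) ⟩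
    K * (K * arcs H) + ∣ D ∣ * c                             ∎)
    where
    A : ℕ → Subset n
    A j = tabulate λ u → lookup (vertices G) u ∧ (p v ≤ᵇ p u + j * K)

    A⁺ : ∀ j {u} → u ∈ vertices G → p v ≤ p u + j * K → u ∈ A j
    A⁺ j {u} u∈V le = T⇒∈ (subst T (sym (lookup∘tabulate _ u))
      (Equivalence.from T-∧ (∈⇒T u∈V , ℕ.≤⇒≤ᵇ le)))

    A⁻ : ∀ j {u} → u ∈ A j → u ∈ vertices G × p v ≤ p u + j * K
    A⁻ j {u} u∈A = let (t , le) = Equivalence.to T-∧ (subst T (lookup∘tabulate _ u) (∈⇒T u∈A)) in
      T⇒∈ t , ℕ.≤ᵇ⇒≤ _ _ le

    stall : ∃[ j ] j < n × A (suc j) ⊆ A j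
    stall = chain-stalls A
      (λ j u∈ → let (u∈V , le) = A⁻ j u∈ in
        A⁺ (suc j) u∈V (ℕ.≤-trans le (ℕ.+-monoʳ-≤ (p _) (ℕ.m≤n+m (j * K) K))))
      (v , A⁺ 0 v∈V (ℕ.m≤m+n (p v) 0))

    j : ℕ
    j = proj₁ stall

    H : Graph n
    H = G [ A j ]

    D : Subset n
    D = vertices H

    D∋ : ∀ {u} → u ∈ vertices G → p v ≤ p u + j * K → u ∈ D
    D∋ u∈V le = x∈p∩q⁺ (u∈V , A⁺ j u∈V le)

    -- A vertex of `A j` is at most `j * K`, hence at most `n * K`, below `v`, and at most `s` above
    -- `K` times its load.
    c : ℕ
    c = s + n * K

    below : ∀ {u w} → u ∈ A j → w ∈ vertices G → w ∉ A j → weight K (p u) (p w) ≡ 0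
    below {u} {w} u∈A w∈V w∉A = weight-0 K (ℕ.+-cancelʳ-≤ (j * K) (p w + K) (p u) (begin
      p w + K + j * K     ≡⟨ ℕ.+-assoc (p w) K (j * K) ⟩
      -- As the chain stalls at `j`, `w` is missing from `A (suc j)` too, so a full `K` separates it
      -- from `u`.
      p w + suc j * K     ≤⟨ ℕ.<⇒≤ (ℕ.≰⇒> λ le → w∉A (proj₂ (proj₂ stall) (A⁺ (suc j) w∈V le))) ⟩
      p v                 ≤⟨ proj₂ (A⁻ j u∈A) ⟩
      p u + j * K         ∎))

    load-inside : ∀ {u} → u ∈ A j → load (adj G) K p u ≤ load (adj H) K p u
    load-inside {u} u∈A = sum-mono λ w → go w (∈⇒T u∈A) (lookup (A j) w) refl (T? (adj G u w))
      where
      go : ∀ w → T (lookup (A j) u) → ∀ b → lookup (A j) w ≡ b → Dec (Adj G u w) →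
           (if adj G u w then weight K (p u) (p w) else 0) ≤ (if adj H u w then weight K (p u) (p w) else 0)
      go w tu b eq (no ¬e) rewrite ¬T⇒false ¬e = z≤n
      go w tu true eq (yes e)
        rewrite Equivalence.to T-≡ e | Equivalence.to T-≡ tu | eq = ℕ.≤-refl
      go w tu false eq (yes e) = ℕ.≤-trans (if-≤ (adj G u w) _)
        (ℕ.≤-trans (ℕ.≤-reflexive (below u∈A (endpoint G w u (subst T (symmetric G u w) e))
          λ w∈ → subst T eq (∈⇒T w∈))) z≤n)

    pointwise : ∀ u → χ (lookup D u) * p v ≤ K * load (adj H) K p u + χ (lookup D u) * c
    pointwise u with lookup D u in eq
    ... | false = z≤n
    ... | true  = begin
      1 * p v                                    ≡⟨ ℕ.*-identityˡ (p v) ⟩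
      p v                                        ≤⟨ proj₂ (A⁻ j u∈A) ⟩
      p u + j * K                                ≤⟨ ℕ.+-mono-≤ (p≤ u) (ℕ.*-monoˡ-≤ K (ℕ.<⇒≤ (proj₁ (proj₂ stall)))) ⟩
      K * load (adj G) K p u + s + n * K         ≡⟨ ℕ.+-assoc _ s (n * K) ⟩
      K * load (adj G) K p u + c                 ≤⟨ ℕ.+-monoˡ-≤ c (ℕ.*-monoʳ-≤ K (load-inside u∈A)) ⟩
      K * load (adj H) K p u + c                 ≡⟨ cong (_+_ (K * load (adj H) K p u)) (ℕ.*-identityˡ c) ⟨
      K * load (adj H) K p u + 1 * c             ∎
      where
      u∈A : u ∈ A j
      u∈A = proj₂ (x∈p∩q⁻ (vertices G) (A j) (lookup⇒[]= u D eq))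

-- Two neighbours in F with larger keys are at least as high, so that each of
-- them gives K to a vertex of H.
density≤heights : (G H : Graph n) → H ⊆ᴳ G → ∀ K p q F →
  (∀ v → K * load (adj G) K p v ≤ p v) → (∀ u v → q v < q u → p v ≤ p u) →
  (∀ v → T (grow (adj G) q F v) → T (F v)) → (∀ v → v ∈ vertices H → ¬ T (F v)) →
  K * (K * arcs H) + ∣ vertices H ∣ * (K * (K * 2)) ≤ sum λ v → χ (lookup (vertices H) v) * p v
density≤heights {n} G H (_ , H⊆G) K p q F load≤ key-reflects grow⊆F avoid = begin
  K * (K * arcs H) + ∣ vertices H ∣ * c                    ≡⟨ cong₂ _+_ (cong (K *_) (sum-load H K p)) (sum-χ-const (vertices H) c) ⟨
  K * sum (load (adj H) K p) + sum (λ v → χ (lookup (vertices H) v) * c)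
                                                           ≡⟨ cong (_+ sum (λ v → χ (lookup (vertices H) v) * c)) (*-distribˡ-sum K (load (adj H) K p)) ⟩
  sum (λ v → K * load (adj H) K p v) + sum (λ v → χ (lookup (vertices H) v) * c)
                                                           ≡⟨ ∑-distrib-+ (λ v → K * load (adj H) K p v) _ ⟨
  sum (λ v → K * load (adj H) K p v + χ (lookup (vertices H) v) * c)  ≤⟨ sum-mono pointwise ⟩
  sum (λ v → χ (lookup (vertices H) v) * p v)              ∎
  where
  c : ℕ
  c = K * (K * 2)

  crowd≥2 : ∀ v → ¬ T (F v) → 2 ≤ crowd (adj G) q F v
  crowd≥2 v v∉F = ℕ.≰⇒> λ le → v∉F (grow⊆F v (ℕ.≤⇒≤ᵇ le))

  -- A neighbour in `F` is outside `H`, so at most one of the two summands on the left is nonzero.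
  split : ∀ v u → (if adj H v u then weight K (p v) (p u) else 0)
    + K * (if adj G v u then (if F u then raise (q u ∸ q v) 0 else 0) else 0)
    ≤ (if adj G v u then weight K (p v) (p u) else 0)
  split v u = go (adj H v u) refl (adj G v u) refl (F u) refl (q u ∸ q v) refl
    where
    w : ℕ
    w = weight K (p v) (p u)

    go : ∀ h → adj H v u ≡ h → ∀ g → adj G v u ≡ g → ∀ f → F u ≡ f → ∀ d → q u ∸ q v ≡ d →
      (if h then w else 0) + K * (if g then (if f then raise d 0 else 0) else 0) ≤ (if g then w else 0)
    go true eh false eg _ _ _ _ = contradiction (H⊆G v u (subst T (sym eh) _)) (subst (¬_ ∘ T) (sym eg) λ ())
    go true eh true eg true ef _ _ = contradiction (subst T (sym ef) _)
      (avoid u (endpoint H u v (subst T (symmetric H v u) (subst T (sym eh) _))))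
    go true eh true eg false ef _ _ = ℕ.≤-reflexive (trans (cong (_+_ w) (ℕ.*-zeroʳ K)) (ℕ.+-identityʳ w))
    go false eh false eg _ _ _ _ = ℕ.≤-reflexive (ℕ.*-zeroʳ K)
    go false eh true eg false ef _ _ = ℕ.≤-trans (ℕ.≤-reflexive (ℕ.*-zeroʳ K)) z≤n
    go false eh true eg true ef zero _ = ℕ.≤-trans (ℕ.≤-reflexive (ℕ.*-zeroʳ K)) z≤n
    go false eh true eg true ef (suc d) eq = ℕ.≤-trans (ℕ.≤-reflexive (ℕ.*-identityʳ K))
      (weight-≥ K (key-reflects u v (ℕ.m∸n≢0⇒n<m λ eq′ → ℕ.1+n≢0 (trans (sym eq) eq′))))

  load-outside : ∀ v → load (adj H) K p v + K * crowd (adj G) q F v ≤ load (adj G) K p v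
  load-outside v = begin
    load (adj H) K p v + K * crowd (adj G) q F v           ≡⟨ cong (_+_ (load (adj H) K p v)) (*-distribˡ-sum K g) ⟩
    load (adj H) K p v + sum (λ u → K * g u)               ≡⟨ ∑-distrib-+ (λ u → if adj H v u then weight K (p v) (p u) else 0) _ ⟨
    sum (λ u → (if adj H v u then weight K (p v) (p u) else 0) + K * g u)  ≤⟨ sum-mono (split v) ⟩
    load (adj G) K p v                                     ∎
    where
    g : Fin n → ℕ
    g u = if adj G v u then (if F u then raise (q u ∸ q v) 0 else 0) else 0

  -- `sum-load` sums over all indices, so those outside `H` must contribute nothing.
  load-empty : ∀ v → lookup (vertices H) v ≡ false → load (adj H) K p v ≡ 0
  load-empty v eq = ℕ.n≤0⇒n≡0 (ℕ.≤-trans (sum-≤ 0 λ u →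
    ℕ.≤-reflexive (cong (if_then weight K (p v) (p u) else 0) (¬T⇒false λ e → subst T eq (∈⇒T (endpoint H v u e)))))
    (ℕ.≤-reflexive (ℕ.*-zeroʳ n)))

  pointwise : ∀ v → K * load (adj H) K p v + χ (lookup (vertices H) v) * c ≤ χ (lookup (vertices H) v) * p v
  pointwise v with lookup (vertices H) v in eq
  ... | false = ℕ.≤-reflexive (trans (ℕ.+-identityʳ _) (trans (cong (K *_) (load-empty v eq)) (ℕ.*-zeroʳ K)))
  ... | true  = begin
    K * load (adj H) K p v + 1 * (K * (K * 2))             ≡⟨ cong (_+_ (K * load (adj H) K p v)) (ℕ.*-identityˡ c) ⟩
    K * load (adj H) K p v + K * (K * 2)                   ≡⟨ ℕ.*-distribˡ-+ K _ (K * 2) ⟨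
    K * (load (adj H) K p v + K * 2)                       ≤⟨ ℕ.*-monoʳ-≤ K (ℕ.+-monoʳ-≤ (load (adj H) K p v)
                                                                (ℕ.*-monoʳ-≤ K (crowd≥2 v (avoid v (lookup⇒[]= v _ eq))))) ⟩
    K * (load (adj H) K p v + K * crowd (adj G) q F v)     ≤⟨ ℕ.*-monoʳ-≤ K (load-outside v) ⟩
    K * load (adj G) K p v                                 ≤⟨ load≤ v ⟩
    p v                                                    ≡⟨ ℕ.*-identityˡ (p v) ⟨
    1 * p v                                                ∎

-- Average degrees as quotients of natural numbers

length-filter-product : ∀ {A B : Set} {m n} {P : A × B → Set} (P? : Decidable P) (f : Fin m → A) (g : Fin n → B) →
  length (filter P? (cartesianProduct (List.tabulate f) (List.tabulate g))) ≡
  sum λ i → sum λ j → χ (does (P? (f i , g j)))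
length-filter-product {m = zero}  P? f g = refl
length-filter-product {m = suc m} P? f g = trans
  (cong length (filter-++ P? (map (f zero ,_) (List.tabulate g)) _))
  (trans (length-++ (filter P? (map (f zero ,_) (List.tabulate g))))
    (cong₂ _+_ (row (f zero) g) (length-filter-product P? (f ∘ suc) g)))
  where
  row : ∀ {n} x (g : Fin n → _) →
        length (filter P? (map (x ,_) (List.tabulate g))) ≡ sum λ j → χ (does (P? (x , g j)))
  row {zero}  x g = refl
  row {suc n} x g with does (P? (x , g zero))
  ... | true  = cong suc (row x (g ∘ suc))
  ... | false = row x (g ∘ suc)

-- `edges` lists an edge only with its smaller end first, while `arcs` counts both orders.
arcs≡2*edges : (G : Graph n) → arcs G ≡ 2 * length (edges G)
arcs≡2*edges G = begin-equality
  arcs G                                             ≡⟨ sum-cong-≗ (λ u → sum-cong-≗ (split u)) ⟩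
  sum (λ u → sum λ v → f u v + f v u)                ≡⟨ sum-cong-≗ (λ u → ∑-distrib-+ (f u) (λ v → f v u)) ⟩
  sum (λ u → sum (f u) + sum (λ v → f v u))          ≡⟨ ∑-distrib-+ (sum ∘ f) (λ u → sum λ v → f v u) ⟩
  e + sum (λ u → sum λ v → f v u)                    ≡⟨ cong (_+_ e) (∑-comm (λ u v → f v u)) ⟩
  e + e                                              ≡⟨ cong (_+_ e) (ℕ.+-identityʳ e) ⟨
  2 * e                                              ≡⟨ cong (2 *_) (length-filter-product (isEdge? G) (λ i → i) (λ i → i)) ⟨
  2 * length (edges G)                               ∎
  where
  f : Fin _ → Fin _ → ℕ
  f u v = χ (does (isEdge? G (u , v)))

  e : ℕ
  e = sum λ u → sum (f u)

  split : ∀ u v → χ (adj G u v) ≡ f u v + f v u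
  split u v with Fin.<-cmp u v
  ... | tri< u<v _ v≮u rewrite dec-true (u Fin.<? v) u<v | dec-false (v Fin.<? u) v≮u =
    sym (ℕ.+-identityʳ (χ (adj G u v)))
  ... | tri> u≮v _ v<u rewrite dec-false (u Fin.<? v) u≮v | dec-true (v Fin.<? u) v<u =
    cong χ (symmetric G u v)
  ... | tri≈ u≮u refl _ rewrite dec-false (u Fin.<? u) u≮u = cong χ (¬T⇒false (irreflexive G u))

-- `_/_` reduces to lowest terms and is opaque on variables. Both sides pass to unnormalised
-- rationals, whose order is cross-multiplication.
ratio-≤⁻ : ∀ a b k l → ratio a (suc k) ≤₋ ratio b (suc l) → a * suc l ≤ b * suc k
ratio-≤⁻ a b k l [ le ]₋ = unpack (ℚᵘ.≤-respʳ-≃ (ℚ.toℚᵘ-fromℚᵘ (mkℚᵘ (+ b) l))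
  (ℚᵘ.≤-respˡ-≃ (ℚ.toℚᵘ-fromℚᵘ (mkℚᵘ (+ a) k)) (ℚ.toℚᵘ-mono-≤ le)))
  where
  unpack : mkℚᵘ (+ a) k ℚᵘ.≤ mkℚᵘ (+ b) l → a * suc l ≤ b * suc k
  unpack (*≤* le) = ℤ.drop‿+≤+ (subst₂ ℤ._≤_ (sym (ℤ.pos-* a (suc l))) (sym (ℤ.pos-* b (suc k))) le)

ratio-≤⁺ : ∀ a b k l → suc l * (a + suc k * 2) ≤ suc k * b →
           ratio a (suc k) ≤₋ ratio b (suc l) -₋ (+ 2 / 1)
ratio-≤⁺ a b k l le = [_]₋ (ℚ.toℚᵘ-cancel-≤ (ℚᵘ.≤-respʳ-≃ (ℚᵘ.≃-sym rhs)
  (ℚᵘ.≤-respˡ-≃ (ℚᵘ.≃-sym (ℚ.toℚᵘ-fromℚᵘ (mkℚᵘ (+ a) k))) (*≤* core))))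
  where
  rhs : toℚᵘ (+ b / suc l ℚ.- + 2 / 1) ℚᵘ.≃ mkℚᵘ (+ b) l ℚᵘ.- mkℚᵘ (+ 2) 0
  rhs = ℚᵘ.≃-trans (ℚ.toℚᵘ-homo-+ (+ b / suc l) (ℚ.- (+ 2 / 1)))
    (ℚᵘ.+-cong (ℚ.toℚᵘ-fromℚᵘ (mkℚᵘ (+ b) l)) (ℚᵘ.≃-reflexive refl))

  A B K L : ℤ
  A = + a
  B = + b
  K = + suc k
  L = + suc l

  leℤ : L ℤ.* (A ℤ.+ K ℤ.* + 2) ℤ.≤ K ℤ.* B
  leℤ = subst₂ ℤ._≤_
    (trans (ℤ.pos-* (suc l) (a + suc k * 2)) (cong (λ i → L ℤ.* (A ℤ.+ i)) (ℤ.pos-* (suc k) 2)))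
    (ℤ.pos-* (suc k) b) (ℤ.+≤+ le)

  eq₁ : ∀ A K L → L ℤ.* (A ℤ.+ K ℤ.* + 2) ℤ.- L ℤ.* K ℤ.* + 2 ≡ A ℤ.* (L ℤ.* + 1)
  eq₁ = ℤSolver.solve-∀

  eq₂ : ∀ B K L → K ℤ.* B ℤ.- L ℤ.* K ℤ.* + 2 ≡ (B ℤ.* + 1 ℤ.+ ℤ.- + 2 ℤ.* L) ℤ.* K
  eq₂ = ℤSolver.solve-∀

  -- This is `leℤ` with `L * K * 2` subtracted on both sides, in the shape of the unnormalised
  -- order.
  core : A ℤ.* + (suc l * 1) ℤ.≤ (B ℤ.* + 1 ℤ.+ ℤ.- + 2 ℤ.* L) ℤ.* K
  core = subst₂ ℤ._≤_
    (trans (eq₁ A K L) (cong (A ℤ.*_) (sym (ℤ.pos-* (suc l) 1)))) (eq₂ B K L)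
    (ℤ.+-monoˡ-≤ (ℤ.- (L ℤ.* K ℤ.* + 2)) leℤ)

averageDegree≡ : (G : Graph n) → averageDegree G ≡ ratio (arcs G) ∣ vertices G ∣
averageDegree≡ G = cong (λ m → ratio m ∣ vertices G ∣) (sym (arcs≡2*edges G))

-- The maximum average degree of the remaining graph

Nonempty⇒∣∣≢0 : {S : Subset n} → Nonempty S → ∣ S ∣ ≢ 0
Nonempty⇒∣∣≢0 {S = S} (x , x∈S) eq = ℕ.n≮0 (subst (∣ S - x ∣ <_) eq (x∈p⇒∣p-x∣<∣p∣ x∈S))

∣∣≢0⇒Nonempty : {S : Subset n} → ∣ S ∣ ≢ 0 → Nonempty S
∣∣≢0⇒Nonempty {n} {S} ≢0 with nonempty? S
... | yes ne = ne
... | no ¬ne = contradiction (trans (cong ∣_∣ (Empty-unique ¬ne)) (∣⊥∣≡0 n)) ≢0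

x∈p─q⇒x∉q : ∀ (p q : Subset n) {x} → x ∈ p ─ q → x ∉ q
x∈p─q⇒x∉q (_ ∷ p) (inside ∷ q) ()         here
x∈p─q⇒x∉q (_ ∷ p) (_ ∷ q)      (there x∈) (there x∈q) = x∈p─q⇒x∉q p q x∈ x∈q

⊆ᴳ-trans : {G H I : Graph n} → G ⊆ᴳ H → H ⊆ᴳ I → G ⊆ᴳ I
⊆ᴳ-trans (V⊆ , E⊆) (V⊆′ , E⊆′) = V⊆′ ∘ V⊆ , λ u v → E⊆′ u v ∘ E⊆ u v

[]⊆ᴳ : (G : Graph n) (S : Subset n) → G [ S ] ⊆ᴳ G
[]⊆ᴳ G S = (λ x∈ → proj₁ (x∈p∩q⁻ (vertices G) S x∈)) , λ u v → proj₁ ∘ Equivalence.to T-∧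

mad≤ : (G : Graph n) (q : ℚ-∞) → (∀ H → H ⊆ᴳ G → averageDegree H ≤₋ q) → mad G ≤₋ q
mad≤ {n} G q bound = max≤v⁺ ℚ-∞-totalOrder (⊥₋≤ q) (All.map⁺ (All.tabulate λ {H} H∈ → bound H (subgraph H H∈)))
  where
  subgraph : ∀ H → H ∈ᴸ subgraphs G → H ⊆ᴳ G
  subgraph H H∈ with ∈-cartesianProductWith⁻ _ (allSubsets n) _ H∈
  ... | S , M , _ , _ , refl = proj₁ ([]⊆ᴳ G S) , λ u v → proj₂ ([]⊆ᴳ G S) u v ∘ proj₁ ∘ Equivalence.to T-∧

-- The error term h * h′ * 3n is smaller than K, so it is lost in a division by K.
separate : ∀ {n K h h′ e e′ P} → suc (n * (n * (n * 3))) ≤ K → h ≤ n → h′ ≤ n →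
  K * (K * e) + h * (K * (K * 2)) ≤ P →
  h′ * P ≤ h * (K * (K * e′) + h′ * (K * (n * 2) + n * K)) →
  h′ * (e + h * 2) ≤ h * e′
separate {n} {K} {h} {h′} {e} {e′} {P} n³<K h≤n h′≤n lower upper =
  ℕ.≮⇒≥ λ lt → ℕ.<-irrefl refl (begin-strict
    K * (h * e′) + r                         <⟨ ℕ.+-monoʳ-< (K * (h * e′)) r<K ⟩
    K * (h * e′) + K                         ≡⟨ trans (ℕ.+-comm _ K) (sym (ℕ.*-suc K (h * e′))) ⟩
    K * suc (h * e′)                         ≤⟨ ℕ.*-monoʳ-≤ K lt ⟩
    K * (h′ * (e + h * 2))                   ≤⟨ ℕ.*-cancelˡ-≤ K {{K≢0}} scaled ⟩
    K * (h * e′) + r                         ∎)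
  where
  K≢0 : NonZero K
  K≢0 = >-nonZero (ℕ.≤-trans (s≤s z≤n) n³<K)

  r : ℕ
  r = h * (h′ * (n * 3))

  r<K : r < K
  r<K = ℕ.≤-trans (s≤s (ℕ.*-mono-≤ h≤n (ℕ.*-monoˡ-≤ (n * 3) h′≤n))) n³<K

  scaled : K * (K * (h′ * (e + h * 2))) ≤ K * (K * (h * e′) + r)
  scaled = begin
    K * (K * (h′ * (e + h * 2)))                                  ≡⟨ lemma₁ K h h′ e ⟩
    h′ * (K * (K * e) + h * (K * (K * 2)))                        ≤⟨ ℕ.*-monoʳ-≤ h′ lower ⟩
    h′ * P                                                        ≤⟨ upper ⟩
    h * (K * (K * e′) + h′ * (K * (n * 2) + n * K))               ≡⟨ lemma₂ K h h′ e′ n ⟩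
    K * (K * (h * e′) + h * (h′ * (n * 3)))                       ∎
    where
    lemma₁ : ∀ K h h′ e → K * (K * (h′ * (e + h * 2))) ≡ h′ * (K * (K * e) + h * (K * (K * 2)))
    lemma₁ = solve-∀

    lemma₂ : ∀ K h h′ e′ n → h * (K * (K * e′) + h′ * (K * (n * 2) + n * K)) ≡ K * (K * (h * e′) + h * (h′ * (n * 3)))
    lemma₂ = solve-∀

module _ (G : Graph n) {K : ℕ} (n³<K : suc (n * (n * (n * 3))) ≤ K) (p q : Fin n → ℕ) (F : Fin n → Bool)
  (load≤ : ∀ v → K * load (adj G) K p v ≤ p v)
  (p≤ : ∀ v → p v ≤ K * load (adj G) K p v + K * (n * 2))
  (reflects : ∀ u v → q v < q u → p v ≤ p u)
  (grow⊆F : ∀ v → T (grow (adj G) q F v) → T (F v)) where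

  -- Two estimates meet in the heights on `H`: their sum is large by `density≤heights`, while each
  -- is at most about `K * K * mad G` by `height≤density`. Fractions are avoided by taking `mad G`
  -- as the average degree of a densest subgraph `H′`.
  remaining-density : ∀ H H′ → H ⊆ᴳ G → (∀ v → v ∈ vertices H → ¬ T (F v)) →
    H′ ⊆ᴳ G → Nonempty (vertices H′) → averageDegree H′ ≡ mad G →
    ∣ vertices H′ ∣ * (arcs H + ∣ vertices H ∣ * 2) ≤ ∣ vertices H ∣ * arcs H′
  remaining-density H H′ H⊆G avoid H′⊆G ne densest = separate n³<K (∣p∣≤n (vertices H)) (∣p∣≤n (vertices H′))
    (density≤heights G H H⊆G K p q F load≤ reflects grow⊆F avoid) (begin
      h′ * sum (λ v → χ (lookup (vertices H) v) * p v)          ≡⟨ *-distribˡ-sum h′ (λ v → χ (lookup (vertices H) v) * p v) ⟩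
      sum (λ v → h′ * (χ (lookup (vertices H) v) * p v))        ≤⟨ sum-mono pointwise ⟩
      sum (λ v → χ (lookup (vertices H) v) * c)                 ≡⟨ sum-χ-const (vertices H) c ⟩
      ∣ vertices H ∣ * c                                        ∎)
    where
    h′ s c : ℕ
    h′ = ∣ vertices H′ ∣
    s  = K * (n * 2) + n * K
    c  = K * (K * arcs H′) + h′ * s

    height≤ : ∀ {v} → v ∈ vertices G → h′ * p v ≤ c
    height≤ {v} v∈V = via (height≤density G K (K * (n * 2)) p p≤ v∈V)
      where
      via : (∃[ A ] Nonempty (vertices (G [ A ])) ×
        ∣ vertices (G [ A ]) ∣ * p v ≤ K * (K * arcs (G [ A ])) + ∣ vertices (G [ A ]) ∣ * s) → h′ * p v ≤ c
      -- `G [ A ]` is no denser than `H′`. Scaling by the orders of both graphs keeps the comparison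
      -- in natural numbers.
      via (A , neA , le) = ℕ.*-cancelˡ-≤ ∣ vertices (G [ A ]) ∣ {{≢-nonZero (Nonempty⇒∣∣≢0 neA)}} (begin
        k * (h′ * p v)                                 ≡⟨ lemma₁ k h′ (p v) ⟩
        h′ * (k * p v)                                 ≤⟨ ℕ.*-monoʳ-≤ h′ le ⟩
        h′ * (K * (K * arcs (G [ A ])) + k * s)        ≡⟨ lemma₂ h′ K (arcs (G [ A ])) k s ⟩
        K * (K * (arcs (G [ A ]) * h′)) + k * (h′ * s) ≤⟨ ℕ.+-monoˡ-≤ (k * (h′ * s)) (ℕ.*-monoʳ-≤ K (ℕ.*-monoʳ-≤ K sparse)) ⟩
        K * (K * (arcs H′ * k)) + k * (h′ * s)         ≡⟨ lemma₃ K (arcs H′) k h′ s ⟩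
        k * c                                          ∎)
        where
        k : ℕ
        k = ∣ vertices (G [ A ]) ∣

        lemma₁ : ∀ k h x → k * (h * x) ≡ h * (k * x)
        lemma₁ = solve-∀

        lemma₂ : ∀ h K e k s → h * (K * (K * e) + k * s) ≡ K * (K * (e * h)) + k * (h * s)
        lemma₂ = solve-∀

        lemma₃ : ∀ K e k h s → K * (K * (e * k)) + k * (h * s) ≡ k * (K * (K * e) + h * s)
        lemma₃ = solve-∀

        cross : ∀ a b k l → k ≢ 0 → l ≢ 0 → ratio a k ≤₋ ratio b l → a * l ≤ b * k
        cross a b zero    l       k≢0 _   _  = contradiction refl k≢0
        cross a b (suc k) zero    _   l≢0 _  = contradiction refl l≢0
        cross a b (suc k) (suc l) _   _   le = ratio-≤⁻ a b k l le

        sparse : arcs (G [ A ]) * h′ ≤ arcs H′ * k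
        sparse = cross (arcs (G [ A ])) (arcs H′) k h′ (Nonempty⇒∣∣≢0 neA) (Nonempty⇒∣∣≢0 ne)
          (subst₂ _≤₋_ (averageDegree≡ (G [ A ])) (trans (sym densest) (averageDegree≡ H′))
            (averageDegree≤mad G (G [ A ]) ([]⊆ᴳ G A)))

    pointwise : ∀ v → h′ * (χ (lookup (vertices H) v) * p v) ≤ χ (lookup (vertices H) v) * c
    pointwise v with lookup (vertices H) v in eq
    ... | false = ℕ.≤-reflexive (ℕ.*-zeroʳ h′)
    ... | true  = subst₂ _≤_ (cong (h′ *_) (sym (ℕ.*-identityˡ (p v)))) (sym (ℕ.*-identityˡ c))
      (height≤ (proj₁ H⊆G (lookup⇒[]= v (vertices H) eq)))

  mad-decreases : (S : Subset n) → (∀ v → v ∈ vertices G → T (F v) → v ∈ S) → mad (G ∖ S) ≤₋ mad G -₋ (+ 2 / 1)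
  mad-decreases S F⊆S = mad≤ (G ∖ S) _ λ H H⊆ →
    subst (_≤₋ mad G -₋ (+ 2 / 1)) (sym (averageDegree≡ H)) (bound H H⊆ ∣ vertices H ∣ refl)
    where
    bound : ∀ H → H ⊆ᴳ G ∖ S → ∀ k → ∣ vertices H ∣ ≡ k → ratio (arcs H) k ≤₋ mad G -₋ (+ 2 / 1)
    -- An empty `H` has average degree `-∞`, which is below everything. The order of `H` is
    -- abstracted to `k`, as `ratio` is defined by cases on it.
    bound H H⊆ zero    eq = ⊥₋≤ _
    bound H H⊆ (suc k) eq =
      via (mad-attained G (x , proj₁ H⊆G x∈H))
      where
      H⊆G : H ⊆ᴳ G
      H⊆G = ⊆ᴳ-trans {G = H} {G ∖ S} {G} H⊆ ([]⊆ᴳ G (vertices G ─ S))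

      inhabited : Nonempty (vertices H)
      inhabited = ∣∣≢0⇒Nonempty {S = vertices H} (λ eq′ → ℕ.1+n≢0 (trans (sym eq) eq′))

      x : Fin n
      x = proj₁ inhabited

      x∈H : x ∈ vertices H
      x∈H = proj₂ inhabited

      avoid : ∀ v → v ∈ vertices H → ¬ T (F v)
      avoid v v∈H t =
        let (v∈V , v∈V─S) = x∈p∩q⁻ (vertices G) (vertices G ─ S) (proj₁ H⊆ v∈H) in
        x∈p─q⇒x∉q (vertices G) S v∈V─S (F⊆S v v∈V t)

      finish : ∀ H′ l → ∣ vertices H′ ∣ ≡ l → l ≢ 0 →
        l * (arcs H + suc k * 2) ≤ suc k * arcs H′ → ratio (arcs H) (suc k) ≤₋ ratio (arcs H′) l -₋ (+ 2 / 1)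
      finish H′ zero    _ l≢0 _  = contradiction refl l≢0
      finish H′ (suc l) _ _   le = ratio-≤⁺ (arcs H) (arcs H′) k l le

      via : (∃[ H′ ] H′ ⊆ᴳ G × Nonempty (vertices H′) × averageDegree H′ ≡ mad G) →
            ratio (arcs H) (suc k) ≤₋ mad G -₋ (+ 2 / 1)
      via (H′ , H′⊆G , ne , densest) = subst (λ r → ratio (arcs H) (suc k) ≤₋ r -₋ (+ 2 / 1))
        (trans (sym (averageDegree≡ H′)) densest)
        (finish H′ ∣ vertices H′ ∣ refl (Nonempty⇒∣∣≢0 ne)
          (subst (λ h → ∣ vertices H′ ∣ * (arcs H + h * 2) ≤ h * arcs H′) eq
            (remaining-density H H′ H⊆G avoid H′⊆G ne densest)))

-- Forests

term≤sum : (f : Fin n → ℕ) → ∀ i → f i ≤ sum f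
term≤sum f zero    = ℕ.m≤m+n (f zero) _
term≤sum f (suc i) = ℕ.≤-trans (term≤sum (f ∘ suc) i) (ℕ.m≤n+m _ (f zero))

two-terms≤sum : (f : Fin n → ℕ) → ∀ {i j} → i ≢ j → f i + f j ≤ sum f
two-terms≤sum f {zero}  {zero}  i≢j = contradiction refl i≢j
two-terms≤sum f {zero}  {suc j} i≢j = ℕ.+-monoʳ-≤ (f zero) (term≤sum (f ∘ suc) j)
two-terms≤sum f {suc i} {zero}  i≢j = ℕ.≤-trans (ℕ.≤-reflexive (ℕ.+-comm (f (suc i)) (f zero)))
  (ℕ.+-monoʳ-≤ (f zero) (term≤sum (f ∘ suc) i))
two-terms≤sum f {suc i} {suc j} i≢j =
  ℕ.≤-trans (two-terms≤sum (f ∘ suc) (i≢j ∘ cong suc)) (ℕ.m≤n+m _ (f zero))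

module _ {A : Set} {R : A → A → Set} where

  linked-last : ∀ {e} a xs → Linked R (a ∷ xs ++ e ∷ []) → ∃[ p ] p ∈ᴸ a ∷ xs × R p e
  linked-last a []       (r ∷ [-]) = a , here refl , r
  linked-last a (x ∷ xs) (_ ∷ l) with linked-last x xs l
  ... | p , p∈ , r = p , there p∈ , r

  -- An inner vertex of a path from `a` to `e` has a predecessor and a successor. They differ
  -- because the list has no repetitions and `e` does not occur in it.
  linked-inner : ∀ {e} a b xs → Unique (a ∷ b ∷ xs) → All (e ≢_) (a ∷ b ∷ xs) →
    Linked R (a ∷ b ∷ xs ++ e ∷ []) → ∀ {x} → x ∈ᴸ b ∷ xs →
    ∃[ p ] ∃[ s ] p ≢ s × R p x × R x s × p ∈ᴸ a ∷ b ∷ xs × s ∈ᴸ b ∷ xs ++ e ∷ []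
  linked-inner {e} a b [] _ (e≢a ∷ _) (r ∷ r′ ∷ _) (here refl) =
    a , e , ≢-sym e≢a , r , r′ , here refl , there (here refl)
  linked-inner a b (c ∷ xs) ((_ ∷ a≢c ∷ _) ∷ _) _ (r ∷ r′ ∷ _) (here refl) =
    a , c , a≢c , r , r′ , here refl , there (here refl)
  linked-inner a b (c ∷ xs) (_ ∷ unique) (_ ∷ e≢) (_ ∷ l) (there x∈)
    with linked-inner b c xs unique e≢ l x∈
  ... | p , s , p≢s , r , r′ , p∈ , s∈ = p , s , p≢s , r , r′ , there p∈ , there s∈

-- The neighbours of `u` are `v` and the last vertex, those of `v` are `u` and `w`, and any other
-- vertex is inner on the path from `v` round to `u`.
cycle-neighbours : (G : Graph n) → ∀ {u v w vs} → IsCycle G u v w vs → ∀ {x} → x ∈ᴸ u ∷ v ∷ w ∷ vs →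
  ∃[ y ] ∃[ z ] y ≢ z × Adj G x y × Adj G x z × y ∈ᴸ u ∷ v ∷ w ∷ vs × z ∈ᴸ u ∷ v ∷ w ∷ vs
cycle-neighbours G {u} {v} {w} {vs} ((_ ∷ v≢ ∷ _) , r ∷ _ ∷ l) (here refl) with linked-last w vs l
... | p , p∈ , r′ = v , p , All.lookup v≢ p∈ , r , subst T (symmetric G p u) r′ , there (here refl) , there (there p∈)
cycle-neighbours G {u} {v} {w} (((_ ∷ u≢w ∷ _) ∷ _) , r ∷ r′ ∷ _) (there (here refl)) =
  u , w , u≢w , subst T (symmetric G u v) r , r′ , here refl , there (there (here refl))
cycle-neighbours G {u} {v} {w} {vs} ((u≢ ∷ unique) , _ ∷ l) (there (there x∈))
  with linked-inner v w vs unique u≢ l x∈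
... | p , s , p≢s , r , r′ , p∈ , s∈ = p , s , p≢s , subst T (symmetric G p _) r , r′ , there p∈ , back (∈-++⁻ (w ∷ vs) s∈)
  where
  back : s ∈ᴸ w ∷ vs ⊎ s ∈ᴸ u ∷ [] → s ∈ᴸ u ∷ v ∷ w ∷ vs
  back (inj₁ s∈)          = there (there s∈)
  back (inj₂ (here refl)) = here refl

crowd≥2 : (a : Fin n → Fin n → Bool) (q : Fin n → ℕ) (F : Fin n → Bool) → ∀ {x y z} → y ≢ z →
  T (a x y) → T (a x z) → T (F y) → T (F z) → q x < q y → q x < q z → 2 ≤ crowd a q F x
crowd≥2 {n} a q F {x} y≢z e e′ Fy Fz lt lt′ =
  ℕ.≤-trans (ℕ.+-mono-≤ (counted e Fy lt) (counted e′ Fz lt′)) (two-terms≤sum f y≢z)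
  where
  f : Fin n → ℕ
  f y = if a x y then (if F y then raise (q y ∸ q x) 0 else 0) else 0

  positive : ∀ b c d → T b → T c → d ≢ 0 → 1 ≤ (if b then (if c then raise d 0 else 0) else 0)
  positive true true zero    _ _ d≢0 = contradiction refl d≢0
  positive true true (suc d) _ _ _   = s≤s z≤n

  counted : ∀ {y} → T (a x y) → T (F y) → q x < q y → 1 ≤ f y
  counted {y} e Fy lt = positive (a x y) (F y) (q y ∸ q x) e Fy (ℕ.m>n⇒m∸n≢0 lt)

-- On a cycle, both neighbours of the vertex with least key would crowd it.
chosen-forest : (G : Graph n) (q : Fin n → ℕ) (F : Fin n → Bool) (S : Subset n) →
  (∀ u v → q u ≡ q v → u ≡ v) → (∀ v → T (F v) → T (grow (adj G) q F v)) → (∀ v → v ∈ S → T (F v)) →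
  IsForest (G [ S ])
chosen-forest {n} G q F S q-injective F⊆grow S⊆F u v w vs cycle =
  no-least (argmin q u (v ∷ w ∷ vs)) x∈ least
  where
  c : List (Fin n)
  c = u ∷ v ∷ w ∷ vs

  x∈ : argmin q u (v ∷ w ∷ vs) ∈ᴸ c
  x∈ = [ here , there ]′ (argmin-sel q u (v ∷ w ∷ vs))

  least : ∀ {y} → y ∈ᴸ c → q (argmin q u (v ∷ w ∷ vs)) ≤ q y
  least (here refl) = f[argmin]≤f[⊤] {f = q} u (v ∷ w ∷ vs)
  least (there y∈)  = All.lookup (f[argmin]≤f[xs] {f = q} u (v ∷ w ∷ vs)) y∈

  no-least : ∀ x → x ∈ᴸ c → ¬ (∀ {y} → y ∈ᴸ c → q x ≤ q y)
  no-least x x∈ least =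
    let (y , z , y≢z , e , e′ , y∈ , z∈) = cycle-neighbours (G [ S ]) cycle x∈
        (g , Fx , Fy)  = edge⁻ y e
        (g′ , _ , Fz)  = edge⁻ z e′
    in ℕ.<⇒≱ (crowd≥2 (adj G) q F {x} {y} {z} y≢z g g′ Fy Fz (above y y∈ e) (above z z∈ e′))
             (ℕ.≤ᵇ⇒≤ (crowd (adj G) q F x) 1 (F⊆grow x Fx))
    where
    edge⁻ : ∀ y → Adj (G [ S ]) x y → Adj G x y × T (F x) × T (F y)
    edge⁻ y e = let (g , s) = Equivalence.to T-∧ e; (sx , sy) = Equivalence.to T-∧ s in
      g , S⊆F x (T⇒∈ sx) , S⊆F y (T⇒∈ sy)

    above : ∀ y → y ∈ᴸ c → Adj (G [ S ]) x y → q x < q y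
    -- Equal keys would mean `y = x`, and the edge would be a loop.
    above y y∈ e = ℕ.≤∧≢⇒< (least y∈) λ eq →
      irreflexive (G [ S ]) x (subst (Adj (G [ S ]) x) (sym (q-injective x y eq)) e)

-- The computed set and its running time

limits : ℕ → Vec ℕ 9
limits n = 3 ∷ n ∷ n * 3 ∷ n * (n * 3) ∷ scale n ∷ scale n + scale n ∷ n * (scale n + scale n) ∷
           suc (ceiling n) ∷ rounds n ∷ []

-- One number must bound the lengths of all lists that are folded over. The sum dominates every
-- single bound and is polynomial by `+-poly`.
limit : ℕ → ℕ
limit n = Vec.sum (limits n)

lookup≤sum : ∀ {m} (v : Vec ℕ m) i → lookup v i ≤ Vec.sum v
lookup≤sum (k ∷ v) zero    = ℕ.m≤m+n k (Vec.sum v)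
lookup≤sum (k ∷ v) (suc i) = ℕ.≤-trans (lookup≤sum v i) (ℕ.m≤n+m (Vec.sum v) k)

limit-poly : PolyBounded limit
limit-poly =
  +-poly (const-poly 3) (+-poly id-poly (+-poly p₁ (+-poly p₂ (+-poly scale-poly
    (+-poly double-poly (+-poly p₃ (+-poly (suc-poly ceiling-poly) (+-poly rounds-poly (const-poly 0)))))))))
  where
  p₁ : PolyBounded (λ n → n * 3)
  p₁ = *-poly id-poly (const-poly 3)

  p₂ : PolyBounded (λ n → n * (n * 3))
  p₂ = *-poly id-poly p₁

  scale-poly : PolyBounded scale
  scale-poly = suc-poly (*-poly id-poly p₂)

  double-poly : PolyBounded (λ n → scale n + scale n)
  double-poly = +-poly scale-poly scale-poly

  p₃ : PolyBounded (λ n → n * (scale n + scale n))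
  p₃ = *-poly id-poly double-poly

  ceiling-poly : PolyBounded ceiling
  ceiling-poly = *-poly scale-poly p₃

  rounds-poly : PolyBounded rounds
  rounds-poly = suc-poly (*-poly id-poly (suc-poly ceiling-poly))

module Solution {n} (G : Graph n) where
  open Dynamics (adj G) using (heights; key; chosen)
  open Heights (adj G) (scale n)

  p q : Fin n → ℕ
  p = heights (scale n) (rounds n)
  q = key p

  F : Fin n → Bool
  F = chosen q (rounds n)

  open Keys (adj G) p
  open Greedy (adj G) q

  S : Subset n
  S = tabulate λ v → lookup (vertices G) v ∧ F v

  S⁻ : ∀ v → v ∈ S → v ∈ vertices G × T (F v)
  S⁻ v v∈S = let (t , f) = Equivalence.to T-∧ (subst T (lookup∘tabulate _ v) (∈⇒T v∈S)) in T⇒∈ t , f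

  S⁺ : ∀ v → v ∈ vertices G → T (F v) → v ∈ S
  S⁺ v v∈V f = T⇒∈ (subst T (sym (lookup∘tabulate _ v)) (Equivalence.from T-∧ (∈⇒T v∈V , f)))

  q<rounds : ∀ v → q v < rounds n
  q<rounds = key< (heights≤ (rounds n))

  Good : Subset n → Set
  Good F = F ⊆ vertices G × IsForest (G [ F ]) × mad (G ∖ F) ≤₋ mad G -₋ (+ 2 / 1)

  good : Good S
  good = (λ {v} v∈S → proj₁ (S⁻ v v∈S)) ,
    chosen-forest G q F S key-injective (λ v → subst T (sym (chosen-fixed q<rounds v))) (λ v → proj₂ ∘ S⁻ v) ,
    mad-decreases G ℕ.≤-refl p q F
      -- `rounds n` exceeds `n * suc (ceiling n)`, the bound for the keys, and thereby also the
      -- bound `n * ceiling n` on the total height.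
      (Kload≤heights (ℕ.≤-<-trans (ℕ.*-monoʳ-≤ n (ℕ.n≤1+n (ceiling n))) (ℕ.n<1+n _)))
      (heights≤Kload (rounds n))
      (λ u v lt → key-reflects v u (ℕ.<⇒≤ lt))
      (λ v → subst T (chosen-fixed q<rounds v))
      S S⁺

  N : ℕ
  N = limit n

  bound : ∀ i → lookup (limits n) i ≤ N
  bound = lookup≤sum (limits n)

  open Execution (adj G) {N} (ℕ.≤-trans (s≤s z≤n) (bound 0F)) (bound 1F)

  ceiling≤N : ceiling n ≤ N
  ceiling≤N = ℕ.≤-trans (ℕ.n≤1+n _) (bound 7F)

  run-mul-rows : ∀ k → k ≤ N → Run N mul (rows ∙ ⌜ k ⌝) ⌜ n * k ⌝
  run-mul-rows k k≤ = run-mul rows ⌜ k ⌝ (vec-bound row) (⌜⌝-bound k≤)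
    ▸ cong ⌜_⌝ (cong₂ _*_ (spine-vec row) (spine-⌜⌝ k))

  run-constants : ∀ {V} → Run N constants (V ∙ rows) (⌜ scale n ⌝ ∙ rows)
  run-constants =
    ((expr & (expr & (expr ⨟ run-mul-rows 3 (bound 0F)) ⨟ run-mul-rows (n * 3) (bound 2F)) ⨟
      run-mul-rows (n * (n * 3)) (bound 3F)) ⨟ expr) & expr

  run-roundCount : Run N roundCount (⌜ scale n ⌝ ∙ rows) ⌜ rounds n ⌝
  run-roundCount =
    expr &
    (expr & (expr & (expr ⨟ run-add⌜⌝ (scale n) (scale n) (bound 4F)) ⨟
        run-mul-rows (scale n + scale n) (bound 5F)) ⨟
      run-mul⌜⌝ (scale n) (n * (scale n + scale n)) (bound 4F) (bound 6F) ⨟ expr) ⨟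
    run-mul-rows (suc (ceiling n)) (bound 7F) ⨟ expr

  run-initial : ∀ {V} → Run N initial (V ∙ rows) (⌜ rounds n ⌝ ∙ (⌜ scale n ⌝ ∙ rows))
  run-initial = run-constants ⨟ run-roundCount & expr

  run-main : Run N main (encodeGraph G) (encodeSubset S)
  run-main = subst₂ (Run N main) (sym input) (sym output)
    (expr &
      ((run-initial ⨟ expr) &
        (((run-initial ⨟ run-climbing (bound 5F) p≤ (λ p v → ℕ.≤-trans (Kload≤ p v) ceiling≤N)
            (λ p v → ℕ.≤-trans (load≤ p v) (bound 6F)) (rounds n) (bound 8F)) & expr ⨟
          run-keys p (p≤ (rounds n))) & expr) ⨟
        run-greedy q (λ v → ℕ.≤-trans (ℕ.<⇒≤ (q<rounds v)) (bound 8F))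
          (λ F v → ℕ.≤-trans (crowd≤ F v) (bound 1F)) (rounds n) (bound 8F)) ⨟
      run-restrict (lookup (vertices G)) q F)
    where
    p≤ : ∀ t v → heights (scale n) t v ≤ N
    p≤ t v = ℕ.≤-trans (heights≤ t v) ceiling≤N

    input : encodeGraph G ≡ vec (encodeBool ∘ lookup (vertices G)) ∙ rows
    input = cong₂ _∙_ (encodeVec-lookup encodeBool (vertices G))
      (trans (encodeVec-tabulate encodeSubset (λ u → tabulate (adj G u)))
        (vec-cong λ u → encodeVec-tabulate encodeBool (adj G u)))

    output : encodeSubset S ≡ vec (λ v → encodeBool (lookup (vertices G) v ∧ F v))
    output = encodeVec-tabulate encodeBool _

size-encodeVec : ∀ {A : Set} (f : A → Tree) (v : Vec A n) → suc n ≤ size (encodeVec f v)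
size-encodeVec f []      = s≤s z≤n
size-encodeVec f (x ∷ v) = s≤s (ℕ.≤-trans (size-encodeVec f v) (ℕ.m≤n+m _ (size (f x))))

-- This turns bounds in the number of indices into bounds in the size of the input.
size-encodeGraph : (G : Graph n) → suc n ≤ size (encodeGraph G)
size-encodeGraph G = ℕ.m≤n⇒m≤1+n (ℕ.≤-trans (size-encodeVec encodeBool (vertices G)) (ℕ.m≤m+n _ _))

polynomial-time : (R : ∀ {n} → Graph n → Subset n → Set) (f : Fun) {N : ℕ → ℕ} → PolyBounded N →
  (∀ {n} (G : Graph n) → ∃[ S ] R G S × Run (N n) f (encodeGraph G) (encodeSubset S)) →
  ComputableInPolynomialTime R
polynomial-time R f {N} N-poly solve with ∘-poly (budget-poly f) N-poly
-- The one additional variable is the stack, which starts as `nil`.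
... | a , d , budget≤ = 1 , compile f , a , d , timed
  where
  timed : ∀ {n} (G : Graph n) → ∃[ S ] R G S × ∃[ t ] Σ (Store 2) λ τ →
    ⟨ compile f , encodeGraph G ∷ nil ∷ [] ⟩⇓⟨ t , τ ⟩ ×
    lookup τ zero ≡ encodeSubset S × t ≤ a * size (encodeGraph G) ^ d + a
  timed {n} G with solve G
  ... | S , r , run with compile-correct run nil
  ... | t , exec , t≤ = S , r , t , _ , exec , refl , (begin
    t                                  ≤⟨ t≤ ⟩
    budget f (N n)                     ≤⟨ budget≤ n ⟩
    a * suc n ^ d                      ≤⟨ ℕ.*-monoʳ-≤ a (ℕ.^-monoˡ-≤ d (size-encodeGraph G)) ⟩
    a * size (encodeGraph G) ^ d       ≤⟨ ℕ.m≤m+n _ a ⟩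
    a * size (encodeGraph G) ^ d + a   ∎)

theorem6 : (∀ {n : ℕ} (G : Graph n) →
    ∃[ F ] F ⊆ vertices G × IsForest (G [ F ]) × mad (G ∖ F) ≤₋ mad G -₋ (+ 2 / 1))
    × ComputableInPolynomialTime (λ G F →
    F ⊆ vertices G × IsForest (G [ F ]) × mad (G ∖ F) ≤₋ mad G -₋ (+ 2 / 1))
theorem6 =
  (λ G → Solution.S G , Solution.good G) ,
  polynomial-time _ main limit-poly (λ G → Solution.S G , Solution.good G , Solution.run-main G)
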